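{- Let $\mathcal M_1=(V,\mathcal I_1)$ and $\mathcal M_2=(V,\mathcal I_2)$ be two matroids on a common finite ground set with $n=|V|$, given by independence oracles, and let $r$ be the maximum cardinality of a common independent set. Suppose that one maximum common independent set is given and that Another Matroid Intersection can be solved in $\mathcal A(n,r)$ independence queries and polynomial space. Then all maximum common independent sets can be enumerated without repetition, in polynomial space and with query delay $O(\mathcal A(n,r))$. More precisely, at most two another-solution calls are made between consecutive outputs and between the last output and termination. If there are $L$ solutions (maximum common independent sets), exactly $2L-1$ another-solution calls are made.
   Context: A common independent set is a member of $\mathcal I_1\cap\mathcal I_2$; maximum means of maximum cardinality. Independence-oracle model: the matroids are accessed only through queries which, given $i\in\{1,2\}$ and $A\subseteq V$, return whether $A\in\mathcal I_i$; the number of queries is counted. Another Matroid Intersection: given two matroids on a common ground set and a maximum common independent set $S$, decide whether there exists a maximum common independent set $T\ne S$ and, if so, output one. $\mathcal A(n,r)$ denotes the worst-case number of independence queries used by the given algorithm for Another Matroid Intersection on an instance with at most $n$ elements and maximum solution size at most $r$, including a call that reports that no other solution exists. An another-solution call is an invocation of this algorithm on a constrained subproblem: for disjoint $\mathit{In},\mathit{Ex}\subseteq V$ and a known member $X$ of $$\mathcal F(\mathit{In},\mathit{Ex})=\{X\in\mathcal I_1\cap\mathcal I_2\mid |X|=r,\ \mathit{In}\subseteq X,\ X\cap\mathit{Ex}=\emptyset\},$$ it returns a member of $\mathcal F(\mathit{In},\mathit{Ex})$ different from $X$, or $\bot$ if none exists. It is run as an ordinary instance of Another Matroid Intersection on the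 matroids $(\mathcal M_i/\mathit{In})\setminus\mathit{Ex}$, $i\in\{1,2\}$, with given solution $X\setminus\mathit{In}$; each derived independence query for $J\subseteq V\setminus(\mathit{In}\cup\mathit{Ex})$ is implemented by the single original query whether $J\cup\mathit{In}\in\mathcal I_i$. The query delay of a deterministic enumeration algorithm is the maximum number of independence queries made before the first output, between two consecutive outputs, or between the last output and termination. -}

module Defs where

open import Data.Bool.Base using (Bool; true; false)
open import Data.Fin.Base using (Fin; zero)
open import Data.Fin.Subset
  using (Subset; inside; outside; ⊥; ⁅_⁆; _∈_; _∉_; _⊆_; _∪_; _∩_; _─_; ∁; ∣_∣; Empty)
open import Data.List.Base as List using (List; []; _∷_; _++_; length)
import Data.List.Membership.Propositional as List∈
open import Data.List.NonEmpty.Base as List⁺ using (List⁺; _∷_)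
open import Data.List.Relation.Unary.Unique.Propositional using (Unique)
open import Data.Maybe.Base as Maybe using (Maybe; just; nothing)
open import Data.Nat.Base using (ℕ; suc; _+_; _*_; _^_; _⊔_; _≤_; _<_)
open import Data.Product.Base using (∃₂; ∃-syntax; _×_; _,_)
open import Data.Vec.Base as Vec using (Vec; []; _∷_; lookup; _[_]≔_; replicate; toList)
open import Function.Bundles using (_⇔_)
open import Relation.Binary.PropositionalEquality.Core using (_≡_; _≢_)
open import Relation.Nullary.Decidable.Core using (does)
open import Relation.Nullary.Negation.Core using (¬_)
open import Relation.Unary using (Pred; Decidable)
open import Level using (0ℓ)

private
  variable
    m n k : ℕ

------------------------------------------------------------------------
-- Matroids and common independent sets

record Matroid (n : ℕ) : Set₁ where
  field
    Indep      : Pred (Subset n) 0ℓ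
    indep?     : Decidable Indep
    ⊥-indep    : Indep ⊥
    hereditary : ∀ {A B} → A ⊆ B → Indep B → Indep A
    augment    : ∀ {A B} → Indep A → Indep B → ∣ A ∣ < ∣ B ∣ →
                 ∃[ x ] x ∈ B × x ∉ A × Indep (A ∪ ⁅ x ⁆)

-- The index set {1,2} of the two matroids is Fin 2.

TwoMatroids : ℕ → Set₁
TwoMatroids n = Fin 2 → Matroid n

CommonIndep : TwoMatroids n → Pred (Subset n) 0ℓ
CommonIndep M A = ∀ i → Matroid.Indep (M i) A

MaxCommonIndep : TwoMatroids n → Pred (Subset n) 0ℓ
MaxCommonIndep M A = CommonIndep M A × (∀ B → CommonIndep M B → ∣ B ∣ ≤ ∣ A ∣)

Constrained : TwoMatroids n → ℕ → (In Ex : Subset n) → Pred (Subset n) 0ℓ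
Constrained M r In Ex X =
  CommonIndep M X × ∣ X ∣ ≡ r × In ⊆ X × Empty (X ∩ Ex)

_HasSize_ : Pred (Subset n) 0ℓ → ℕ → Set
P HasSize L = ∃[ Ts ] Unique Ts × (∀ T → T List∈.∈ Ts ⇔ P T) × length Ts ≡ L

------------------------------------------------------------------------
-- Independence oracles, and oracles of minors

Oracles : ℕ → Set
Oracles n = Fin 2 → Subset n → Bool

oracles : TwoMatroids n → Oracles n
oracles M i A = does (Matroid.indep? (M i) A)

-- A subset U of Fin n is itself a ground set of ∣ U ∣ elements, which
-- are renumbered in increasing order.  `embed U` reads a subset of it as
-- a subset of Fin n; `restrict U` intersects with U and renumbers.

embed : (U : Subset n) → Subset ∣ U ∣ → Subset n
embed []            []      = []
embed (inside  ∷ U) (b ∷ J) = b ∷ embed U J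
embed (outside ∷ U) J       = outside ∷ embed U J

restrict : (U : Subset n) → Subset n → Subset ∣ U ∣
restrict []            []      = []
restrict (inside  ∷ U) (b ∷ X) = b ∷ restrict U X
restrict (outside ∷ U) (b ∷ X) = restrict U X

free : (In Ex : Subset n) → Subset n
free In Ex = ∁ (In ∪ Ex)

lift : (In Ex : Subset n) → Subset ∣ free In Ex ∣ → Subset n
lift In Ex J = embed (free In Ex) J ∪ In

-- Independence in (M i / In) ∖ Ex, by one query to M i.

minorOracles : Oracles n → (In Ex : Subset n) → Oracles ∣ free In Ex ∣
minorOracles O In Ex i J = O i (lift In Ex J)

------------------------------------------------------------------------
-- Programs
--
-- The computation model is the multi-stack machine (equivalently, up to
-- constant factors in space, the multi-tape Turing machine) with
-- structured control.  A program has a fixed number k of registers, each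
-- a stack of bits, and is one finite object serving all input sizes.
-- There is no recursion, so the control state takes constant space and
-- the space used is the total length of the registers.  `Op` supplies the
-- operations other than stack manipulation.

Word : Set
Word = List Bool

Store : ℕ → Set
Store = Vec Word

infixr 5 _⨾_

data Program (Op : Set) (k : ℕ) : Set where
  skip  : Program Op k
  _⨾_   : (p q : Program Op k) → Program Op k
  push  : Bool → Fin k → Program Op k
  -- Pop a register and branch: it was empty / had top false / had top true.
  case  : Fin k → (p q t : Program Op k) → Program Op k
  -- Iterate as long as the register is nonempty.
  while : Fin k → (p : Program Op k) → Program Op k
  op    : Op → Program Op k

size : Store k → ℕ
size σ = Vec.sum (Vec.map length σ)

-- The input is in register zero, all others are empty.

initial : Word → Store (suc k)
initial w = w ∷ replicate _ []

-- `Step o σ τ es w` : the operation o leads from σ to τ, causing the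
-- events es and using w cells of workspace besides the registers.

OpSemantics : (Op Event : Set) (k : ℕ) → Set₁
OpSemantics Op Event k = Op → Store k → Store k → List Event → ℕ → Set

-- `Run Step p σ τ es s` : started in σ, the program p halts in τ, having
-- caused the events es in this order and used space s at its peak.  There
-- is no Run of a program that diverges, or that applies an operation to an
-- ill-formed argument.  At most one of the rules applies, so if Step is
-- deterministic, τ, es and s are determined by p and σ.

data Run {Op Event : Set} {k : ℕ} (Step : OpSemantics Op Event k) :
         Program Op k → Store k → Store k → List Event → ℕ → Set where

  skip : ∀ {σ} → Run Step skip σ σ [] (size σ)

  _⨾_  : ∀ {p q σ τ υ es fs s t} →
         Run Step p σ τ es s → Run Step q τ υ fs t →
         Run Step (p ⨾ q) σ υ (es ++ fs) (s ⊔ t)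

  push : ∀ {b r σ} →
         Run Step (push b r) σ (σ [ r ]≔ (b ∷ lookup σ r)) []
             (size (σ [ r ]≔ (b ∷ lookup σ r)))

  case-empty : ∀ {r p q t σ τ es s} → lookup σ r ≡ [] →
               Run Step p σ τ es s →
               Run Step (case r p q t) σ τ es s

  case-false : ∀ {r p q t σ τ es s w} → lookup σ r ≡ false ∷ w →
               Run Step q (σ [ r ]≔ w) τ es s →
               Run Step (case r p q t) σ τ es (size σ ⊔ s)

  case-true  : ∀ {r p q t σ τ es s w} → lookup σ r ≡ true ∷ w →
               Run Step t (σ [ r ]≔ w) τ es s →
               Run Step (case r p q t) σ τ es (size σ ⊔ s)

  while-done : ∀ {r p σ} → lookup σ r ≡ [] →
               Run Step (while r p) σ σ [] (size σ)

  while-loop : ∀ {r p σ τ υ es fs s t b w} → lookup σ r ≡ b ∷ w →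
               Run Step p σ τ es s → Run Step (while r p) τ υ fs t →
               Run Step (while r p) σ υ (es ++ fs) (s ⊔ t)

  op   : ∀ {o σ τ es w} → Step o σ τ es w →
         Run Step (op o) σ τ es ((size σ + w) ⊔ size τ)

------------------------------------------------------------------------
-- Algorithms for Another Matroid Intersection

-- A set A ⊆ Fin n is written as the bit string toList A of length n; in
-- particular the input set also conveys n.

data QueryOp (k : ℕ) : Set where
  query : Fin 2 → (arg ans : Fin k) → QueryOp k

data QueryStep (O : Oracles n) :
               OpSemantics (QueryOp k) (Fin 2 × Subset n) k where
  query : ∀ {i arg ans} {σ : Store k} A → lookup σ arg ≡ toList A →
          QueryStep O (query i arg ans)
                    σ (σ [ ans ]≔ (O i A ∷ [])) ((i , A) ∷ []) 0

record AnotherAlgorithm : Set where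
  field
    extraRegisters : ℕ
    program        : Program (QueryOp (suc extraRegisters)) (suc extraRegisters)

-- `nothing` is the answer ⊥ "no other solution".

encode : Maybe (Subset n) → Word
encode nothing  = false ∷ []
encode (just T) = true ∷ toList T

-- `Answers P O S T? qs s` : with the oracles O and the given solution S,
-- P halts with answer T? (in register zero), having made the queries qs
-- and used space s.

Answers : AnotherAlgorithm → Oracles n → Subset n → Maybe (Subset n) →
          List (Fin 2 × Subset n) → ℕ → Set
Answers P O S T? qs s =
  ∃[ τ ] Run (QueryStep O) program (initial (toList S)) τ qs s
       × lookup τ zero ≡ encode T?
  where open AnotherAlgorithm P

IsAnother : TwoMatroids n → Subset n → Maybe (Subset n) → Set
IsAnother M S (just T) = MaxCommonIndep M T × T ≢ S
IsAnother M S nothing  = ¬ (∃[ T ] MaxCommonIndep M T × T ≢ S)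

-- P is correct, uses at most A n r queries on every instance with at most
-- n elements and maximum solution size at most r, and space B m on m
-- elements.

SolvesAnother : AnotherAlgorithm → (A : ℕ → ℕ → ℕ) (B : ℕ → ℕ) → Set₁
SolvesAnother P A B =
  ∀ {m} (M : TwoMatroids m) (S : Subset m) → MaxCommonIndep M S →
  ∃[ T? ] ∃[ qs ] ∃[ s ]
    Answers P (oracles M) S T? qs s ×
    IsAnother M S T? ×
    (∀ n r → m ≤ n → ∣ S ∣ ≤ r → length qs ≤ A n r) ×
    s ≤ B m

PolynomiallyBounded : (ℕ → ℕ) → Set
PolynomiallyBounded f = ∃₂ λ c d → ∀ n → f n ≤ c * suc n ^ d

------------------------------------------------------------------------
-- Enumeration algorithms

data EnumOp (k : ℕ) : Set where
  query  : Fin 2 → (arg ans : Fin k) → EnumOp k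
  call   : (in′ ex x ans : Fin k) → EnumOp k
  output : Fin k → EnumOp k

data Event (n : ℕ) : Set where
  query  : Fin 2 → Subset n → Event n
  call   : (In Ex X : Subset n) → Event n
  output : Subset n → Event n

Trace : ℕ → Set
Trace n = List (Event n)

liftQuery : (In Ex : Subset n) → Fin 2 × Subset ∣ free In Ex ∣ → Event n
liftQuery In Ex (i , J) = query i (lift In Ex J)

-- A call runs P on the minor with given solution X ∖ In.  The queries of
-- P appear in the trace as the original queries implementing them.  The
-- workspace of a call is that of P, plus n cells for the argument of the
-- original query.

data EnumStep (P : AnotherAlgorithm) (O : Oracles n) :
              OpSemantics (EnumOp k) (Event n) k where

  query  : ∀ {i arg ans} {σ : Store k} A → lookup σ arg ≡ toList A →
           EnumStep P O (query i arg ans)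
                    σ (σ [ ans ]≔ (O i A ∷ [])) (query i A ∷ []) 0

  call   : ∀ {in′ ex x ans} {σ : Store k} In Ex X {T? qs s} →
           lookup σ in′ ≡ toList In →
           lookup σ ex ≡ toList Ex →
           lookup σ x ≡ toList X →
           Answers P (minorOracles O In Ex) (restrict (free In Ex) (X ─ In))
                   T? qs s →
           EnumStep P O (call in′ ex x ans)
                    σ (σ [ ans ]≔ encode (Maybe.map (lift In Ex) T?))
                    (call In Ex X ∷ List.map (liftQuery In Ex) qs) (s + n)

  output : ∀ {r} {σ : Store k} A → lookup σ r ≡ toList A →
           EnumStep P O (output r) σ σ (output A ∷ []) 0

record EnumAlgorithm : Set where
  field
    extraRegisters : ℕ
    program        : Program (EnumOp (suc extraRegisters)) (suc extraRegisters)

-- `Terminates E P O S es s` : with the subroutine P, the oracles O and the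
-- given solution S, E terminates with trace es, having used space s.

Terminates : EnumAlgorithm → AnotherAlgorithm → Oracles n → Subset n →
             Trace n → ℕ → Set
Terminates E P O S es s =
  ∃[ τ ] Run (EnumStep P O) program (initial (toList S)) τ es s
  where open EnumAlgorithm E

------------------------------------------------------------------------
-- Measures on traces

outputs : Trace n → List (Subset n)
outputs []                = []
outputs (output A   ∷ es) = A ∷ outputs es
outputs (query _ _  ∷ es) = outputs es
outputs (call _ _ _ ∷ es) = outputs es

#queries : Trace n → ℕ
#queries []                = 0
#queries (query _ _  ∷ es) = suc (#queries es)
#queries (call _ _ _ ∷ es) = #queries es
#queries (output _   ∷ es) = #queries es

#calls : Trace n → ℕ
#calls []                = 0
#calls (call _ _ _ ∷ es) = suc (#calls es)
#calls (query _ _  ∷ es) = #calls es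
#calls (output _   ∷ es) = #calls es

-- The trace cut at its outputs: the head is the part before the first
-- output, the tail holds the parts between consecutive outputs and the
-- part between the last output and termination.

cut : Event n → List⁺ (Trace n) → List⁺ (Trace n)
cut (output _)     ss       = [] ∷ List⁺.toList ss
cut (query i A)    (s ∷ ss) = (query i A ∷ s) ∷ ss
cut (call In Ex X) (s ∷ ss) = (call In Ex X ∷ s) ∷ ss

segments : Trace n → List⁺ (Trace n)
segments []       = [] ∷ []
segments (e ∷ es) = cut e (segments es)

queryDelay : Trace n → ℕ
queryDelay es = List.foldr _⊔_ 0 (List.map #queries (List⁺.toList (segments es)))

EnumeratesExactly : Pred (Subset n) 0ℓ → Trace n → Set
EnumeratesExactly P es =
  Unique (outputs es) × (∀ T → T List∈.∈ outputs es ⇔ P T)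

-- Every call is on a constrained subproblem of the intended kind.

data AdmissibleEvent (M : TwoMatroids n) (r : ℕ) : Event n → Set where
  query  : ∀ {i A} → AdmissibleEvent M r (query i A)
  output : ∀ {A} → AdmissibleEvent M r (output A)
  call   : ∀ {In Ex X} → Empty (In ∩ Ex) → Constrained M r In Ex X →
           AdmissibleEvent M r (call In Ex X)

{-# OPTIONS --safe #-}
module Submission where

-- Binary partition: a task is a set D of elements together with a solution X
-- and stands for the solutions that agree with X on D, that is In = D ∩ X and
-- Ex = D ∖ X.  If an another-solution call returns Y, then the task splits at
-- the first element e at which X and Y differ into (D ∪ {e}, X) and
-- (D ∪ {e}, Y).  Tasks wait on two stacks, one for tasks whose X has already
-- been output and one for the others, and a round processes one task of each
-- kind: it outputs the solution of a new task, makes a call for it, and makes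
-- a call for an old task.  A split adds one task to either stack, and a task
-- that does not split just disappears, so the heights of the stacks stay in
-- step.  Only the last round lacks its second call, whence 2L - 1 calls.
-- Since ∣D∣ grows along both stacks, their heights are O(n).

open import Defs
open import Algebra.Properties.CommutativeSemigroup using (interchange; x∙yz≈y∙xz)
open import Data.Bool.Base using (Bool; true; false; _∧_; _∨_; _xor_; not; if_then_else_)
open import Data.Bool.Properties as Bool using (∨-identityʳ; ∨-zeroʳ)
open import Data.Fin.Base using (Fin; zero; suc)
open import Data.Fin.Patterns using (0F; 1F; 2F; 3F; 4F; 5F; 6F)
open import Data.Fin.Properties using (all?)
open import Data.Fin.Subset hiding (⊤)
open import Data.Fin.Subset.Properties
open import Data.List.Base as List using (List; []; _∷_; _++_; length)
open import Data.List.Membership.Propositional using () renaming (_∈_ to _∈ˡ_)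
open import Data.List.Membership.Propositional.Properties.WithK using (unique∧set⇒bag)
open import Data.List.NonEmpty.Base as List⁺ using (_∷_; head; tail)
open import Data.List.Properties using (++-identityʳ)
open import Data.List.Relation.Binary.BagAndSetEquality using (∼bag⇒↭)
open import Data.List.Relation.Binary.Permutation.Propositional.Properties using (↭-length)
open import Data.List.Relation.Unary.All as All using (All; []; _∷_)
open import Data.List.Relation.Unary.All.Properties using (++⁺)
open import Data.List.Relation.Unary.AllPairs using ([]; _∷_)
open import Data.List.Relation.Unary.Any using (here; there)
open import Data.List.Relation.Unary.Unique.Propositional using (Unique)
open import Data.Maybe.Base as Maybe using (Maybe; just; nothing)
open import Data.Nat.Base
  using (ℕ; zero; suc; pred; _+_; _*_; _^_; _∸_; _⊔_; _≤_; _<_; z≤n; s≤s)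
open import Data.Nat.Induction using (<-wellFounded)
open import Data.Nat.ListAction using (sum)
open import Data.Nat.Properties as ℕ hiding (_≟_)
open import Data.Nat.Solver using (module +-*-Solver)
open import Data.Product.Base using (∃-syntax; _×_; _,_; proj₁; proj₂)
open import Data.Sum.Base using (_⊎_; inj₁; inj₂)
open import Data.Unit.Base using (⊤; tt)
open import Data.Vec.Base using ([]; _∷_; lookup; _[_]≔_; toList; here; there)
open import Data.Vec.Properties
  using ([]≔-lookup; []≔-idempotent; lookup∘updateAt; ≡-dec; lookup⇒[]=; []=⇒lookup; length-toList)
open import Function.Bundles using (_⇔_; mk⇔; module Equivalence)
open import Induction.WellFounded using (Acc; acc)
open import Relation.Binary.PropositionalEquality
  using (_≡_; _≢_; refl; sym; trans; cong; cong₂; subst; subst₂)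
open import Relation.Nullary using (Dec; yes; no; ¬_; contradiction; _×-dec_; _→-dec_; ¬?)

private
  variable
    n : ℕ

-- The enumeration program

-- Opaque, so that the continuation can be inferred by unification.
opaque
  pop : {Op : Set} {k : ℕ} → Fin k → (Bool → Program Op k) → Program Op k
  pop r p = case r skip (p false) (p true)

clear : {Op : Set} {k : ℕ} → Fin k → Program Op k
clear r = while r (pop r λ _ → skip)

-- `case` branches only by popping, so the bit is put back before `p` runs.
when : {Op : Set} {k : ℕ} → Fin k → Program Op k → Program Op k
when r p = pop r λ b → push b r ⨾ p

-- The `true` on top marks an entry; a `false` in this position marks the lower end of a task.
putEntry : {Op : Set} {k : ℕ} (d x : Bool) → Fin k → Program Op k
putEntry d x r = push x r ⨾ push d r ⨾ push true r

module Registers {Op : Set} where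

  Prog : Set
  Prog = Program Op 7

  -- Registers: 0 the answer of the last call, 1 and 2 the two stacks of tasks
  -- (1: solution already output, 2: not yet), 3, 4, 5 the sets In, Ex, X of
  -- the current task, 6 a flag.

  loadEntry : Fin 7 → Prog
  loadEntry r =
    case r skip
      -- At the end marker the flag is emptied, which stops the loop in `load`.
      (pop 6F λ _ → skip)
      (pop r λ d → pop r λ x →
        push (d ∧ x) 3F ⨾ push (d ∧ not x) 4F ⨾ push x 5F)

  load : Fin 7 → Prog
  load r = push true 6F ⨾ while 6F (loadEntry r)

  emit : (d x y : Bool) → Prog
  emit d x y = putEntry d x 1F ⨾ putEntry d y 2F

  splitEntry : Prog
  splitEntry =
    pop 3F λ i → pop 4F λ e → pop 5F λ x → pop 0F λ y →
      if x xor y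
      -- `case` consumes the flag, so only the first difference finds it set and puts its element
      -- into `D`. Elsewhere the bit of `D` is `i ∨ e`, as `D` is the union of In and Ex.
      then case 6F (emit (i ∨ e) x y) (emit true x y) (emit true x y)
      else emit (i ∨ e) x y

  split : Prog
  split = push true 6F ⨾ push false 1F ⨾ push false 2F ⨾
          while 5F splitEntry ⨾ clear 6F

  discard : Prog
  discard = clear 3F ⨾ clear 4F ⨾ clear 5F

  initEntry : Prog
  initEntry = pop 0F λ y → putEntry false y 2F

  start : Prog
  start = push false 2F ⨾ while 0F initEntry

  opaque
    processTask : Fin 7 → (announce ask : Prog) → Prog
    processTask r announce ask =
      -- Popping the leading bit of the answer tells whether there is a solution, and if so leaves
      -- just its bits in register 0 for `split`.
      load r ⨾ announce ⨾ ask ⨾ case 0F skip discard split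

  enumerate : (announce ask : Prog) → Prog
  enumerate announce ask =
    start ⨾ while 2F (processTask 2F announce ask ⨾
                      when 1F (processTask 1F skip ask))

enumeration : EnumAlgorithm
enumeration = record
  { extraRegisters = 6
  ; program = Registers.enumerate (op (output 5F)) (op (call 3F 4F 5F 0F))
  }

-- Space

-- The old length is added on the left in place of a truncated subtraction on the right.
size-update : ∀ {k} (σ : Store k) r w →
              size (σ [ r ]≔ w) + length (lookup σ r) ≡ size σ + length w
size-update (v ∷ σ) zero    w = trans (+-comm (length w + size σ) (length v))
  (trans (cong (length v +_) (+-comm (length w) (size σ)))
         (sym (+-assoc (length v) (size σ) (length w))))
size-update (v ∷ σ) (suc r) w =
  trans (+-assoc (length v) _ _)
  (trans (cong (length v +_) (size-update σ r w)) (sym (+-assoc (length v) _ _)))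

size-update-≤ : ∀ {k} (σ : Store k) r w →
                size (σ [ r ]≔ w) ≤ size σ + length w
size-update-≤ σ r w = ≤-trans (m≤m+n _ _) (≤-reflexive (size-update σ r w))

size-push : ∀ {k} (σ : Store k) r b →
            size (σ [ r ]≔ (b ∷ lookup σ r)) ≡ size σ + 1
size-push σ r b = +-cancelʳ-≡ (length (lookup σ r)) _ _
  (trans (size-update σ r _) (sym (+-assoc (size σ) 1 _)))

size-pop : ∀ {k} (σ : Store k) r {b w} → lookup σ r ≡ b ∷ w →
           size (σ [ r ]≔ w) ≤ size σ
size-pop σ r {b} {w} eq = +-cancelʳ-≤ (length w) _ _
  (≤-trans (+-monoʳ-≤ (size (σ [ r ]≔ w)) (n≤1+n (length w)))
  (≤-reflexive (subst (λ v → size (σ [ r ]≔ w) + length v ≡ size σ + length w)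
                      eq (size-update σ r w))))

module Growth {Op Event : Set} {k : ℕ} (Step : OpSemantics Op Event k) where

  -- g bounds the excess of the space used over the initial size; unlike the
  -- peak space itself, this is additive under composition.
  record Grows (p : Program Op k) (σ τ : Store k) (es : List Event) (g : ℕ) :
               Set where
    constructor grows
    field
      {space} : ℕ
      run     : Run Step p σ τ es space
      space≤  : space ≤ size σ + g
      final≤  : size τ ≤ size σ + g

  open Grows public

  private
    variable
      p q t : Program Op k
      σ τ υ : Store k
      es fs : List Event
      g h s : ℕ
      r : Fin k
      b : Bool
      w : Word

    chain : ∀ {a b m} g h → b ≤ a + g → m ≤ b + h → m ≤ a + (g + h)
    chain {a} g h b≤ m≤ = ≤-trans m≤
      (≤-trans (+-monoˡ-≤ h b≤) (≤-reflexive (+-assoc a g h)))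

    skipFirst : ∀ {a m} g h → m ≤ a + g → m ≤ a + (g + h)
    skipFirst {a} g h m≤ = ≤-trans m≤ (+-monoʳ-≤ a (m≤m+n g h))

  weaken : g ≤ h → Grows p σ τ es g → Grows p σ τ es h
  weaken {σ = σ} g≤h (grows R s t) =
    grows R (≤-trans s (+-monoʳ-≤ (size σ) g≤h)) (≤-trans t (+-monoʳ-≤ (size σ) g≤h))

  skip′ : Grows skip σ σ [] 0
  skip′ {σ = σ} = grows skip (m≤m+n _ 0) (m≤m+n (size σ) 0)

  infixr 5 _⨾′_

  _⨾′_ : Grows p σ τ es g → Grows q τ υ fs h → Grows (p ⨾ q) σ υ (es ++ fs) (g + h)
  _⨾′_ {g = g} {h = h} (grows R s t) (grows R′ s′ t′) =
    grows (R ⨾ R′) (⊔-lub (skipFirst g h s) (chain g h t s′)) (chain g h t t′)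

  push′ : Grows (push b r) σ (σ [ r ]≔ (b ∷ lookup σ r)) [] 1
  push′ {b} {r} {σ} = grows push (≤-reflexive (size-push σ r b)) (≤-reflexive (size-push σ r b))

  empty′ : lookup σ r ≡ [] → Grows p σ τ es g → Grows (case r p q t) σ τ es g
  empty′ eq (grows R s t) = grows (case-empty eq R) s t

  -- Popping shrinks the store, so a bound relative to the smaller store is also one relative to
  -- `σ`.
  false′ : lookup σ r ≡ false ∷ w → Grows q (σ [ r ]≔ w) τ es g →
           Grows (case r p q t) σ τ es g
  false′ {σ = σ} {r = r} {g = g} eq (grows R s t) = grows (case-false eq R)
    (⊔-lub (m≤m+n _ g) (≤-trans s (+-monoˡ-≤ g (size-pop σ r eq))))
    (≤-trans t (+-monoˡ-≤ g (size-pop σ r eq)))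

  true′ : lookup σ r ≡ true ∷ w → Grows t (σ [ r ]≔ w) τ es g →
          Grows (case r p q t) σ τ es g
  true′ {σ = σ} {r = r} {g = g} eq (grows R s t) = grows (case-true eq R)
    (⊔-lub (m≤m+n _ g) (≤-trans s (+-monoˡ-≤ g (size-pop σ r eq))))
    (≤-trans t (+-monoˡ-≤ g (size-pop σ r eq)))

  opaque
    unfolding pop

    pop′ : ∀ {p : Bool → Program Op k} b → lookup σ r ≡ b ∷ w →
           Grows (p b) (σ [ r ]≔ w) τ es g → Grows (pop r p) σ τ es g
    pop′ false = false′
    pop′ true  = true′

  done′ : lookup σ r ≡ [] → Grows (while r p) σ σ [] 0
  done′ {σ = σ} eq = grows (while-done eq) (m≤m+n _ 0) (m≤m+n (size σ) 0)

  loop′ : lookup σ r ≡ b ∷ w → Grows p σ τ es g → Grows (while r p) τ υ fs h →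
          Grows (while r p) σ υ (es ++ fs) (g + h)
  loop′ {g = g} {h = h} eq (grows R s t) (grows R′ s′ t′) =
    grows (while-loop eq R R′) (⊔-lub (skipFirst g h s) (chain g h t s′)) (chain g h t t′)

-- Encoding of tasks as words

pattern store y a b i e x f = y ∷ a ∷ b ∷ i ∷ e ∷ x ∷ f ∷ []

-- The entries of a task end up in reverse order, so that popping them restores
-- the order of D and X.
stash : ∀ {m} → Subset m → Subset m → Word → Word
stash []      []      w = w
stash (d ∷ D) (x ∷ X) w = stash D X (true ∷ d ∷ x ∷ w)

Task : ℕ → Set
Task n = Subset n × Subset n

encodeStack : ∀ {n} → List (Task n) → Word
encodeStack []             = []
encodeStack ((D , X) ∷ ts) = stash D X (false ∷ encodeStack ts)

-- Used with the end marker as `b`: thanks to it, even a task on the empty ground set leaves a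
-- nonempty register, so the emptiness tests of the main loop detect whether a task is left.
stash-nonempty : ∀ {m} (D X : Subset m) b w → ∃[ c ] ∃[ v ] stash D X (b ∷ w) ≡ c ∷ v
stash-nonempty []      []      b w = b , w , refl
stash-nonempty (d ∷ D) (x ∷ X) b w = stash-nonempty D X true (d ∷ x ∷ b ∷ w)

length-stash : ∀ {m} (D X : Subset m) w → length (stash D X w) ≡ m * 3 + length w
length-stash []      []      w = refl
length-stash {suc m} (d ∷ D) (x ∷ X) w =
  trans (length-stash D X _)
  (trans (sym (+-assoc (m * 3) 3 (length w))) (cong (_+ length w) (+-comm (m * 3) 3)))

-- `pending`: X and Y have not differed so far.
addFirstDiff : ∀ {m} (pending : Bool) (D X Y : Subset m) → Subset m
addFirstDiff p []      []      []      = []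
addFirstDiff p (d ∷ D) (x ∷ X) (y ∷ Y) =
  (if p ∧ (x xor y) then true else d) ∷ addFirstDiff (p ∧ not (x xor y)) D X Y

flag : Bool → Word
flag p = if p then true ∷ [] else []

-- Runs of the phases of the program

module Phases {Op Event : Set} (Step : OpSemantics Op Event 7) where

  open Growth Step public
  open Registers {Op}

  clear′ : ∀ {σ : Store 7} r w → lookup σ r ≡ w → Grows (clear r) σ (σ [ r ]≔ []) [] 0
  clear′ {σ} r []      eq = subst (λ τ → Grows (clear r) σ τ [] 0)
    (trans (sym ([]≔-lookup σ r)) (cong (σ [ r ]≔_) eq)) (done′ eq)
  clear′ {σ} r (b ∷ w) eq = subst (λ τ → Grows (clear r) σ τ [] 0)
    ([]≔-idempotent σ r)
    (loop′ eq (pop′ b eq skip′) (clear′ r w (lookup∘updateAt r σ)))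

  discard′ : ∀ {y a b i e x f} →
             Grows discard (store y a b i e x f) (store y a b [] [] [] f) [] 0
  discard′ {i = i} {e} {x} = clear′ 3F i refl ⨾′ clear′ 4F e refl ⨾′ clear′ 5F x refl

  -- The register of a stack (true: solutions not yet output), and the store in
  -- which this stack is s and the other one is o.
  stack : Bool → Fin 7
  stack false = 1F
  stack true  = 2F

  storeAt : (side : Bool) (s o i e x f : Word) → Store 7
  storeAt side s o i e x f =
    store [] (if side then o else s) (if side then s else o) i e x f

  loadEntry-mark : ∀ side {s o i e x} →
    Grows (loadEntry (stack side)) (storeAt side (false ∷ s) o i e x (true ∷ []))
          (storeAt side s o i e x []) [] 0
  loadEntry-mark false = false′ refl (pop′ true refl skip′)
  loadEntry-mark true  = false′ refl (pop′ true refl skip′)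

  loadEntry-entry : ∀ side d x {s o i e xs f} →
    Grows (loadEntry (stack side)) (storeAt side (true ∷ d ∷ x ∷ s) o i e xs f)
          (storeAt side s o (d ∧ x ∷ i) (d ∧ not x ∷ e) (x ∷ xs) f) [] 3
  loadEntry-entry false d x =
    true′ refl (pop′ d refl (pop′ x refl (push′ ⨾′ push′ ⨾′ push′)))
  loadEntry-entry true  d x =
    true′ refl (pop′ d refl (pop′ x refl (push′ ⨾′ push′ ⨾′ push′)))

  -- The last entry is on top, so induction along `D` meets the iterations in reverse. Hence the run
  -- `R` of the iterations still to come is an argument, and each entry prepends one iteration to
  -- it.
  loadLoop : ∀ side {m} (D X : Subset m) {s o i e x τ g} →
    Grows (while 6F (loadEntry (stack side)))
          (storeAt side s o (toList (D ∩ X) ++ i) (toList (D ∩ ∁ X) ++ e) (toList X ++ x)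
                   (true ∷ [])) τ [] g →
    Grows (while 6F (loadEntry (stack side)))
          (storeAt side (stash D X s) o i e x (true ∷ [])) τ [] (m * 3 + g)
  loadLoop side []      []      R = R
  loadLoop side {suc m} (d ∷ D) (x ∷ X) {g = g} R =
    subst (Grows _ _ _ _)
      (trans (sym (+-assoc (m * 3) 3 g)) (cong (_+ g) (+-comm (m * 3) 3)))
      (loadLoop side D X (loop′ refl (loadEntry-entry side d _) R))

  load′ : ∀ side {m} (D X : Subset m) {s o} →
    Grows (load (stack side)) (storeAt side (stash D X (false ∷ s)) o [] [] [] [])
          (storeAt side s o (toList (D ∩ X)) (toList (D ∩ ∁ X)) (toList X) [])
          [] (1 + (m * 3 + 0))
  load′ side D X
    rewrite sym (++-identityʳ (toList (D ∩ X))) | sym (++-identityʳ (toList (D ∩ ∁ X)))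
          | sym (++-identityʳ (toList X)) =
    push′ ⨾′
    loadLoop side D X
      (loop′ refl (loadEntry-mark side) (done′ refl))

  emit′ : ∀ d x y {y′ a b i e xs f} → 
    Grows (emit d x y) (store y′ a b i e xs f)
       (store y′ (true ∷ d ∷ x ∷ a) (true ∷ d ∷ y ∷ b) i e xs f) [] 6
  emit′ d x y = (push′ ⨾′ push′ ⨾′ push′) ⨾′ (push′ ⨾′ push′ ⨾′ push′)

  splitEntry′ : ∀ p i e x y {is es xs ys a b} →
    let d = if p ∧ (x xor y) then true else i ∨ e in
    Grows splitEntry
      (store (y ∷ ys) a b (i ∷ is) (e ∷ es) (x ∷ xs) (flag p))
      (store ys (true ∷ d ∷ x ∷ a) (true ∷ d ∷ y ∷ b) is es xs (flag (p ∧ not (x xor y))))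
      [] 6
  splitEntry′ p i e x y =
    pop′ i refl (pop′ e refl (pop′ x refl (pop′ y refl (branch p x y))))
    where
    branch : ∀ p x y {is es xs ys a b} →
      Grows (if x xor y then case 6F (emit (i ∨ e) x y) (emit true x y) (emit true x y)
                        else emit (i ∨ e) x y)
        (store ys a b is es xs (flag p))
        (store ys (true ∷ (if p ∧ (x xor y) then true else i ∨ e) ∷ x ∷ a)
                  (true ∷ (if p ∧ (x xor y) then true else i ∨ e) ∷ y ∷ b)
                  is es xs (flag (p ∧ not (x xor y)))) [] 6
    branch p x y with x xor y
    branch true  x y | true  = true′ refl (emit′ true x y)
    branch false x y | true  = empty′ refl (emit′ (i ∨ e) x y)
    branch true  x y | false = emit′ (i ∨ e) x y
    branch false x y | false = emit′ (i ∨ e) x y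

  -- Here the words are consumed in the order of the induction. The final flag stays unspecified,
  -- since `clearFlag` handles both values.
  splitLoop : ∀ p {m} (I E X Y : Subset m) {a b} →
    let D = addFirstDiff p (I ∪ E) X Y in
    ∃[ q ] Grows (while 5F splitEntry)
      (store (toList Y) a b (toList I) (toList E) (toList X) (flag p))
      (store [] (stash D X a) (stash D Y b) [] [] [] (flag q)) [] (m * 6)
  splitLoop p [] [] [] [] = p , done′ refl
  splitLoop p (i ∷ I) (e ∷ E) (x ∷ X) (y ∷ Y)
    with splitLoop (p ∧ not (x xor y)) I E X Y
  ... | q , R = q , loop′ refl (splitEntry′ p i e x y) R

  clearFlag : ∀ q {y a b i e x} →
    Grows (clear 6F) (store y a b i e x (flag q)) (store y a b i e x []) [] 0
  clearFlag q = clear′ 6F (flag q) refl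

  split′ : ∀ {m} (I E X Y : Subset m) {a b} →
    let D = addFirstDiff true (I ∪ E) X Y in
    Grows split
      (store (toList Y) a b (toList I) (toList E) (toList X) [])
      (store [] (stash D X (false ∷ a)) (stash D Y (false ∷ b)) [] [] [] [])
      [] (3 + (m * 6 + 0))
  split′ I E X Y with splitLoop true I E X Y
  ... | q , R = push′ ⨾′ push′ ⨾′ push′ ⨾′ R ⨾′ clearFlag q

  startLoop : ∀ {m} (S : Subset m) {b} →
    Grows (while 0F initEntry) (store (toList S) [] b [] [] [] [])
      (store [] [] (stash ⊥ S b) [] [] [] []) [] (m * 3)
  startLoop []      = done′ refl
  startLoop (x ∷ S) = loop′ refl (pop′ x refl (push′ ⨾′ push′ ⨾′ push′)) (startLoop S)

  start′ : ∀ {m} (S : Subset m) →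
    Grows start (initial (toList S)) (store [] [] (encodeStack ((⊥ , S) ∷ [])) [] [] [] [])
      [] (1 + m * 3)
  start′ S = push′ ⨾′ startLoop S

  -- The contents `a` will be an encoded stack, which does not reduce to a cons cell; so
  -- nonemptiness enters as an equation. The growth by 1 is the bit that is pushed back.
  when′ : ∀ {p : Program Op 7} {y a b i e x f τ es g c v} → a ≡ c ∷ v →
    Grows p (store y a b i e x f) τ es g →
    Grows (when 1F p) (store y a b i e x f) τ es (1 + g)
  when′ {c = c} refl R = pop′ c refl (push′ ⨾′ R)

  opaque
    unfolding pop

    whenEmpty′ : ∀ {p : Program Op 7} {y b i e x f} →
      Grows (when 1F p) (store y [] b i e x f) (store y [] b i e x f) [] 0
    whenEmpty′ = empty′ refl skip′

-- Minors

_≟ˢ_ : (A B : Subset n) → Dec (A ≡ B)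
_≟ˢ_ = ≡-dec Bool._≟_

∣p∪q∣≡∣p∣+∣q∣ : (p q : Subset n) → Empty (p ∩ q) → ∣ p ∪ q ∣ ≡ ∣ p ∣ + ∣ q ∣
∣p∪q∣≡∣p∣+∣q∣ []            []            e = refl
∣p∪q∣≡∣p∣+∣q∣ (inside  ∷ p) (inside  ∷ q) e = contradiction (zero , here) e
∣p∪q∣≡∣p∣+∣q∣ (inside  ∷ p) (outside ∷ q) e = cong suc (∣p∪q∣≡∣p∣+∣q∣ p q (drop-∷-Empty e))
∣p∪q∣≡∣p∣+∣q∣ (outside ∷ p) (inside  ∷ q) e =
  trans (cong suc (∣p∪q∣≡∣p∣+∣q∣ p q (drop-∷-Empty e))) (sym (+-suc ∣ p ∣ ∣ q ∣))
∣p∪q∣≡∣p∣+∣q∣ (outside ∷ p) (outside ∷ q) e = ∣p∪q∣≡∣p∣+∣q∣ p q (drop-∷-Empty e)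

∣embed∣ : (U : Subset n) (J : Subset ∣ U ∣) → ∣ embed U J ∣ ≡ ∣ J ∣
∣embed∣ []            []            = refl
∣embed∣ (inside  ∷ U) (inside  ∷ J) = cong suc (∣embed∣ U J)
∣embed∣ (inside  ∷ U) (outside ∷ J) = ∣embed∣ U J
∣embed∣ (outside ∷ U) J             = ∣embed∣ U J

embed⊆ : (U : Subset n) (J : Subset ∣ U ∣) → embed U J ⊆ U
embed⊆ []            []      x∈         = x∈
embed⊆ (inside  ∷ U) (b ∷ J) here       = here
embed⊆ (inside  ∷ U) (b ∷ J) (there x∈) = there (embed⊆ U J x∈)
embed⊆ (outside ∷ U) J       (there x∈) = there (embed⊆ U J x∈)

embed-⊥ : (U : Subset n) → embed U ⊥ ≡ ⊥
embed-⊥ []            = refl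
embed-⊥ (inside  ∷ U) = cong (outside ∷_) (embed-⊥ U)
embed-⊥ (outside ∷ U) = cong (outside ∷_) (embed-⊥ U)

-- The element x of U is the element y of the renumbered ground set.
locate : (U : Subset n) (A : Subset ∣ U ∣) {x : Fin n} → x ∈ embed U A →
         ∃[ y ] y ∈ A × (∀ {B} → y ∈ B → x ∈ embed U B) ×
                (∀ B → embed U (B ∪ ⁅ y ⁆) ≡ embed U B ∪ ⁅ x ⁆)
locate (inside ∷ U) (inside ∷ A) here =
  zero , here , (λ { here → here }) ,
  λ { (b ∷ B) → cong (_ ∷_) (trans (cong (embed U) (∪-identityʳ B)) (sym (∪-identityʳ (embed U B)))) }
locate (inside ∷ U) (a ∷ A) (there x∈) with locate U A x∈
... | y , y∈ , mem , add =
  suc y , there y∈ , (λ { (there y∈B) → there (mem y∈B) }) ,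
  λ { (b ∷ B) → cong (_ ∷_) (add B) }
locate (outside ∷ U) A (there x∈) with locate U A x∈
... | y , y∈ , mem , add =
  y , y∈ , (λ y∈B → there (mem y∈B)) , λ B → cong (outside ∷_) (add B)

embed-mono : (U : Subset n) {A B : Subset ∣ U ∣} → A ⊆ B → embed U A ⊆ embed U B
embed-mono U {A} A⊆B x∈ with locate U A x∈
... | y , y∈ , mem , _ = mem (A⊆B y∈)

embed-restrict : (U X : Subset n) → embed U (restrict U X) ≡ U ∩ X
embed-restrict []            []      = refl
embed-restrict (inside  ∷ U) (x ∷ X) = cong (x ∷_) (embed-restrict U X)
embed-restrict (outside ∷ U) (x ∷ X) = cong (outside ∷_) (embed-restrict U X)

restrict-embed-∪ : (U I : Subset n) (J : Subset ∣ U ∣) → Empty (U ∩ I) →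
                   restrict U (embed U J ∪ I) ≡ J
restrict-embed-∪ []            []            []      e = refl
restrict-embed-∪ (inside  ∷ U) (inside  ∷ I) (b ∷ J) e = contradiction (zero , here) e
restrict-embed-∪ (inside  ∷ U) (outside ∷ I) (b ∷ J) e =
  cong₂ _∷_ (∨-identityʳ b) (restrict-embed-∪ U I J (drop-∷-Empty e))
restrict-embed-∪ (outside ∷ U) (i ∷ I)       J       e =
  restrict-embed-∪ U I J (drop-∷-Empty e)

module _ (In Ex : Subset n) where

  private
    U = free In Ex

  In∩free : Empty (U ∩ In)
  In∩free (x , x∈) with x∈p∩q⁻ U In x∈
  ... | x∈U , x∈In = x∈∁p⇒x∉p x∈U (p⊆p∪q Ex x∈In)

  free-Ex : ∀ {x} → x ∈ U → x ∉ Ex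
  free-Ex x∈U x∈Ex = x∈∁p⇒x∉p x∈U (q⊆p∪q In Ex x∈Ex)

  ∣lift∣ : ∀ J → ∣ lift In Ex J ∣ ≡ ∣ J ∣ + ∣ In ∣
  ∣lift∣ J = trans
    (∣p∪q∣≡∣p∣+∣q∣ (embed U J) In λ { (x , x∈) → let (l , r) = x∈p∩q⁻ (embed U J) In x∈ in
      In∩free (x , x∈p∩q⁺ (embed⊆ U J l , r)) })
    (cong (_+ ∣ In ∣) (∣embed∣ U J))

  In⊆lift : ∀ J → In ⊆ lift In Ex J
  In⊆lift J = q⊆p∪q (embed U J) In

  lift-disjoint : Empty (In ∩ Ex) → ∀ J → Empty (lift In Ex J ∩ Ex)
  lift-disjoint e J (x , x∈) with x∈p∩q⁻ (lift In Ex J) Ex x∈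
  ... | l , x∈Ex with x∈p∪q⁻ (embed U J) In l
  ...   | inj₁ x∈J  = free-Ex (embed⊆ U J x∈J) x∈Ex
  ...   | inj₂ x∈In = e (x , x∈p∩q⁺ (x∈In , x∈Ex))

  lift-mono : ∀ {J K} → J ⊆ K → lift In Ex J ⊆ lift In Ex K
  lift-mono {J} {K} J⊆K x∈ with x∈p∪q⁻ (embed U J) In x∈
  ... | inj₁ x∈J  = p⊆p∪q In (embed-mono U J⊆K x∈J)
  ... | inj₂ x∈In = In⊆lift K x∈In

  lift-injective : ∀ {J K} → lift In Ex J ≡ lift In Ex K → J ≡ K
  lift-injective {J} {K} eq =
    trans (sym (restrict-embed-∪ U In J In∩free))
    (trans (cong (restrict U) eq) (restrict-embed-∪ U In K In∩free))

  -- An element of `T` outside `In` is outside `Ex` as well, hence free and kept by `restrict`.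
  lift-restrict : ∀ {T} → In ⊆ T → Empty (T ∩ Ex) →
                  lift In Ex (restrict U (T ─ In)) ≡ T
  lift-restrict {T} In⊆T e rewrite embed-restrict U (T ─ In) = ⊆-antisym to from
    where
    to : (U ∩ (T ─ In)) ∪ In ⊆ T
    to x∈ with x∈p∪q⁻ (U ∩ (T ─ In)) In x∈
    ... | inj₁ l = p─q⊆p T In (proj₂ (x∈p∩q⁻ U (T ─ In) l))
    ... | inj₂ r = In⊆T r
    from : T ⊆ (U ∩ (T ─ In)) ∪ In
    from {x} x∈ with x ∈? In
    ... | yes x∈In = q⊆p∪q (U ∩ (T ─ In)) In x∈In
    ... | no  x∉In = p⊆p∪q In (x∈p∩q⁺ (x∉p⇒x∈∁p x∉In∪Ex , x∈p∧x∉q⇒x∈p─q x∈ x∉In))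
      where
      x∉In∪Ex : x ∉ In ∪ Ex
      x∉In∪Ex x∈∪ with x∈p∪q⁻ In Ex x∈∪
      ... | inj₁ x∈In = x∉In x∈In
      ... | inj₂ x∈Ex = e (x , x∈p∩q⁺ (x∈ , x∈Ex))

  -- As `In` is independent, independence of `J` in the contraction is independence of `J` together
  -- with `In`. With this choice of `indep?`, the oracles of the minors are definitionally the
  -- `minorOracles`.
  minor : (M : Matroid n) → Matroid.Indep M In → Matroid ∣ U ∣
  minor M In-indep = record
    { Indep      = λ J → Indep (lift In Ex J)
    ; indep?     = λ J → indep? (lift In Ex J)
    ; ⊥-indep    = subst (λ A → Indep (A ∪ In)) (sym (embed-⊥ U))
                     (subst Indep (sym (∪-identityˡ In)) In-indep)
    ; hereditary = λ J⊆K → hereditary (lift-mono J⊆K)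
    ; augment    = augment′
    }
    where
    open Matroid M
    augment′ : ∀ {J K} → Indep (lift In Ex J) → Indep (lift In Ex K) → ∣ J ∣ < ∣ K ∣ →
               ∃[ x ] x ∈ K × x ∉ J × Indep (lift In Ex (J ∪ ⁅ x ⁆))
    augment′ {J} {K} J-indep K-indep J<K
      -- `lift` adds `∣ In ∣` to both cardinalities, so augmentation in `M` applies. Its element is
      -- not in `In`, which both sets contain, hence it comes from `K` and `locate` renumbers it.
      with augment J-indep K-indep
             (subst₂ _<_ (sym (∣lift∣ J)) (sym (∣lift∣ K)) (+-monoˡ-< ∣ In ∣ J<K))
    ... | x , x∈ , x∉ , indep with x∈p∪q⁻ (embed U K) In x∈
    ...   | inj₂ x∈In = contradiction (In⊆lift J x∈In) x∉
    ...   | inj₁ x∈K with locate U K x∈K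
    ...     | y , y∈K , mem , add =
      y , y∈K , (λ y∈J → x∉ (p⊆p∪q In (mem y∈J))) , hereditary sub indep
      where
      sub : lift In Ex (J ∪ ⁅ y ⁆) ⊆ lift In Ex J ∪ ⁅ x ⁆
      sub z∈ rewrite add J with x∈p∪q⁻ (embed U J ∪ ⁅ x ⁆) In z∈
      ... | inj₂ z∈In = p⊆p∪q ⁅ x ⁆ (In⊆lift J z∈In)
      ... | inj₁ z∈l with x∈p∪q⁻ (embed U J) ⁅ x ⁆ z∈l
      ...   | inj₁ z∈J = p⊆p∪q ⁅ x ⁆ (p⊆p∪q In z∈J)
      ...   | inj₂ z∈x = q⊆p∪q (lift In Ex J) ⁅ x ⁆ z∈x

-- Constrained subproblems as instances on minors

IsOther : TwoMatroids n → ℕ → (In Ex X : Subset n) → Maybe (Subset n) → Set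
IsOther M r In Ex X (just T) = Constrained M r In Ex T × T ≢ X
IsOther M r In Ex X nothing  = ∀ T → Constrained M r In Ex T → T ≡ X

module ConstrainedSubproblem
  (M : TwoMatroids n) (r : ℕ) (max : ∀ T → CommonIndep M T → ∣ T ∣ ≤ r)
  (In Ex X : Subset n) (disjoint : Empty (In ∩ Ex)) (X-sol : Constrained M r In Ex X)
  where

  private
    X-common = proj₁ X-sol
    ∣X∣≡r    = proj₁ (proj₂ X-sol)
    In⊆X     = proj₁ (proj₂ (proj₂ X-sol))
    X∩Ex     = proj₂ (proj₂ (proj₂ X-sol))

    M′ : TwoMatroids ∣ free In Ex ∣
    M′ i = minor In Ex (M i) (Matroid.hereditary (M i) In⊆X (X-common i))

    X′ : Subset ∣ free In Ex ∣
    X′ = restrict (free In Ex) (X ─ In)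

    lift-X′ : lift In Ex X′ ≡ X
    lift-X′ = lift-restrict In Ex In⊆X X∩Ex

    ∣X′∣+∣In∣ : ∣ X′ ∣ + ∣ In ∣ ≡ r
    ∣X′∣+∣In∣ = trans (sym (∣lift∣ In Ex X′)) (trans (cong ∣_∣ lift-X′) ∣X∣≡r)

    X′-max : MaxCommonIndep M′ X′
    X′-max =
      (λ i → subst (Matroid.Indep (M i)) (sym lift-X′) (X-common i)) ,
      λ J J-common → +-cancelʳ-≤ ∣ In ∣ _ _
        (subst₂ _≤_ (∣lift∣ In Ex J) (sym ∣X′∣+∣In∣) (max (lift In Ex J) J-common))

    -- `X′` is maximum in the minors, so a maximum `J` has its cardinality, and adding `In` gives
    -- `r`. Together with `complete`, the maximum solutions of the minors correspond to the
    -- constrained ones.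
    sound : ∀ {J} → MaxCommonIndep M′ J → Constrained M r In Ex (lift In Ex J)
    sound {J} (J-common , J-max) =
      J-common ,
      trans (∣lift∣ In Ex J) (trans (cong (_+ ∣ In ∣) ∣J∣≡∣X′∣) ∣X′∣+∣In∣) ,
      In⊆lift In Ex J , lift-disjoint In Ex disjoint J
      where
      ∣J∣≡∣X′∣ : ∣ J ∣ ≡ ∣ X′ ∣
      ∣J∣≡∣X′∣ = ≤-antisym (proj₂ X′-max J J-common) (J-max X′ (proj₁ X′-max))

    complete : ∀ T → Constrained M r In Ex T → ∃[ J ] lift In Ex J ≡ T × MaxCommonIndep M′ J
    complete T (T-common , ∣T∣≡r , In⊆T , T∩Ex) =
      J , lift-J , (λ i → subst (Matroid.Indep (M i)) (sym lift-J) (T-common i)) ,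
      λ K K-common → ≤-trans (proj₂ X′-max K K-common) (≤-reflexive ∣X′∣≡∣J∣)
      where
      J = restrict (free In Ex) (T ─ In)
      lift-J = lift-restrict In Ex In⊆T T∩Ex
      ∣X′∣≡∣J∣ : ∣ X′ ∣ ≡ ∣ J ∣
      ∣X′∣≡∣J∣ = +-cancelʳ-≡ ∣ In ∣ _ _
        (trans ∣X′∣+∣In∣ (trans (sym ∣T∣≡r) (trans (cong ∣_∣ (sym lift-J)) (∣lift∣ In Ex J))))

    isOther : ∀ T? → IsAnother M′ X′ T? → IsOther M r In Ex X (Maybe.map (lift In Ex) T?)
    isOther (just J) (J-max , J≢X′) =
      sound J-max , λ eq → J≢X′ (lift-injective In Ex (trans eq (sym lift-X′)))
    isOther nothing none T T-sol with T ≟ˢ X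
    ... | yes eq = eq
    ... | no T≢X with complete T T-sol
    ...   | J , refl , J-max =
      contradiction (J , J-max , λ { refl → T≢X lift-X′ }) none

  another : ∀ {P A B} → SolvesAnother P A B →
    ∃[ T? ] ∃[ qs ] ∃[ s ]
      Answers P (minorOracles (oracles M) In Ex) (restrict (free In Ex) (X ─ In)) T? qs s ×
      IsOther M r In Ex X (Maybe.map (lift In Ex) T?) ×
      length qs ≤ A n r ×
      s ≤ B ∣ free In Ex ∣
  another solves with solves M′ X′ X′-max
  ... | T? , qs , s , answers , isAnother , #qs , s≤ =
    T? , qs , s , answers , isOther T? isAnother ,
    #qs n r (∣p∣≤n (free In Ex)) (≤-trans (m≤m+n _ _) (≤-reflexive ∣X′∣+∣In∣)) , s≤

-- Tasks

Agree : (D X T : Subset n) → Set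
Agree D X T = ∀ i → i ∈ D → lookup X i ≡ lookup T i

agree? : (D X T : Subset n) → Dec (Agree D X T)
agree? D X T = all? λ i → (i ∈? D) →-dec (lookup X i Bool.≟ lookup T i)

addFirstDiff-false : (D X Y : Subset n) → addFirstDiff false D X Y ≡ D
addFirstDiff-false []      []      []      = refl
addFirstDiff-false (d ∷ D) (x ∷ X) (y ∷ Y) = cong (d ∷_) (addFirstDiff-false D X Y)

-- Passes from the bitwise form, which the split loop computes, to a single new element `e`. Beyond
-- the first difference nothing is pending, and `addFirstDiff-false` applies.
addFirstDiff-true : (D X Y : Subset n) → X ≢ Y →
  ∃[ e ] lookup X e ≢ lookup Y e × addFirstDiff true D X Y ≡ D ∪ ⁅ e ⁆
addFirstDiff-true []      []      []      X≢Y = contradiction refl X≢Y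
addFirstDiff-true (d ∷ D) (x ∷ X) (y ∷ Y) X≢Y with x Bool.≟ y
addFirstDiff-true (d ∷ D) (false ∷ X) (false ∷ Y) X≢Y | yes refl
  with addFirstDiff-true D X Y (λ eq → X≢Y (cong (false ∷_) eq))
... | e , neq , eq = suc e , neq , cong₂ _∷_ (sym (∨-identityʳ d)) eq
addFirstDiff-true (d ∷ D) (true ∷ X) (true ∷ Y) X≢Y | yes refl
  with addFirstDiff-true D X Y (λ eq → X≢Y (cong (true ∷_) eq))
... | e , neq , eq = suc e , neq , cong₂ _∷_ (sym (∨-identityʳ d)) eq
addFirstDiff-true (d ∷ D) (false ∷ X) (false ∷ Y) X≢Y | no x≢y = contradiction refl x≢y
addFirstDiff-true (d ∷ D) (true  ∷ X) (true  ∷ Y) X≢Y | no x≢y = contradiction refl x≢y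
addFirstDiff-true (d ∷ D) (false ∷ X) (true  ∷ Y) X≢Y | no x≢y =
  zero , x≢y , cong₂ _∷_ (sym (∨-zeroʳ d)) (trans (addFirstDiff-false D X Y) (sym (∪-identityʳ D)))
addFirstDiff-true (d ∷ D) (true  ∷ X) (false ∷ Y) X≢Y | no x≢y =
  zero , x≢y , cong₂ _∷_ (sym (∨-zeroʳ d)) (trans (addFirstDiff-false D X Y) (sym (∪-identityʳ D)))

-- Indicators and multiplicities

⟦_⟧ : {P : Set} → Dec P → ℕ
⟦ yes _ ⟧ = 1
⟦ no _  ⟧ = 0

⟦⟧-no : {P : Set} (p : Dec P) → ¬ P → ⟦ p ⟧ ≡ 0
⟦⟧-no (yes p) ¬p = contradiction p ¬p
⟦⟧-no (no _)  ¬p = refl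

⟦⟧-partition : {P Q R : Set} (p : Dec P) (q : Dec Q) (r : Dec R) →
               (P → Q ⊎ R) → (Q → P) → (R → P) → (Q → ¬ R) → ⟦ p ⟧ ≡ ⟦ q ⟧ + ⟦ r ⟧
⟦⟧-partition (yes p) (yes q) (yes r) f g h k = contradiction r (k q)
⟦⟧-partition (yes p) (yes q) (no r)  f g h k = refl
⟦⟧-partition (yes p) (no q)  (yes r) f g h k = refl
⟦⟧-partition (yes p) (no q)  (no r)  f g h k with f p
... | inj₁ q′ = contradiction q′ q
... | inj₂ r′ = contradiction r′ r
⟦⟧-partition (no p)  (yes q) r       f g h k = contradiction (g q) p
⟦⟧-partition (no p)  (no q)  (yes r) f g h k = contradiction (h r) p
⟦⟧-partition (no p)  (no q)  (no r)  f g h k = refl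

-- Once the multiplicity of each set among the outputs equals the indicator of being a solution,
-- exactness and absence of repetitions both follow.
multiplicity : Subset n → List (Subset n) → ℕ
multiplicity T Ts = sum (List.map (λ X → ⟦ X ≟ˢ T ⟧) Ts)

∈⇒multiplicity>0 : ∀ {T : Subset n} {Ts} → T ∈ˡ Ts → 1 ≤ multiplicity T Ts
∈⇒multiplicity>0 {T = T} (here refl) with T ≟ˢ T
... | yes _  = s≤s z≤n
... | no neq = contradiction refl neq
∈⇒multiplicity>0 {T = T} {Ts = X ∷ _} (there T∈) =
  ≤-trans (∈⇒multiplicity>0 T∈) (m≤n+m _ ⟦ X ≟ˢ T ⟧)

multiplicity>0⇒∈ : ∀ {T : Subset n} Ts → 1 ≤ multiplicity T Ts → T ∈ˡ Ts
multiplicity>0⇒∈ {T = T} (X ∷ Ts) pos with X ≟ˢ T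
... | yes eq = here (sym eq)
... | no _   = there (multiplicity>0⇒∈ Ts pos)

multiplicity≤1⇒Unique : ∀ (Ts : List (Subset n)) → (∀ T → multiplicity T Ts ≤ 1) → Unique Ts
multiplicity≤1⇒Unique []       _  = []
multiplicity≤1⇒Unique (X ∷ Ts) ≤1 =
  All.tabulate (λ { {T} T∈ refl → <⇒≱ (twice T∈) (≤1 X) }) ∷
  multiplicity≤1⇒Unique Ts (λ T → ≤-trans (m≤n+m _ ⟦ X ≟ˢ T ⟧) (≤1 T))
  where
  twice : X ∈ˡ Ts → 2 ≤ multiplicity X (X ∷ Ts)
  twice X∈ with X ≟ˢ X
  ... | yes _  = s≤s (∈⇒multiplicity>0 X∈)
  ... | no neq = contradiction refl neq

-- The weight of a task bounds the number of nodes of a binary tree of height k.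
weight : ℕ → ℕ
weight zero    = 1
weight (suc k) = suc (weight k + weight k)

weight>0 : ∀ k → 1 ≤ weight k
weight>0 zero    = s≤s z≤n
weight>0 (suc k) = s≤s z≤n

measure : List (Task n) → ℕ
measure {n} ts = sum (List.map (λ (D , _) → weight (n ∸ ∣ D ∣)) ts)

-- Fixed elements become more numerous up the stack; this bounds its height.
Deep : ℕ → List (Task n) → Set
Deep c []             = ⊤
Deep c ((D , X) ∷ ts) = c + 2 * length ts ≤ ∣ D ∣ × Deep c ts

Deep⇒height≤ : ∀ c (ts : List (Task n)) → Deep c ts → length ts ≤ suc n
Deep⇒height≤ c []             deep = z≤n
Deep⇒height≤ c ((D , X) ∷ ts) (le , _) = s≤s
  (≤-trans (m≤m+n (length ts) _) (≤-trans (m≤n+m _ c) (≤-trans le (∣p∣≤n D))))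

module Tasks (M : TwoMatroids n) (r : ℕ) where

  Fits : Task n → Subset n → Set
  Fits (D , X) T = CommonIndep M T × ∣ T ∣ ≡ r × Agree D X T

  fits? : ∀ t T → Dec (Fits t T)
  fits? (D , X) T =
    all? (λ i → Matroid.indep? (M i) T) ×-dec ∣ T ∣ ℕ.≟ r ×-dec agree? D X T

  other? : ∀ t T → Dec (Fits t T × T ≢ proj₂ t)
  other? t T = fits? t T ×-dec ¬? (T ≟ˢ proj₂ t)

  Valid : Task n → Set
  Valid t = Fits t (proj₂ t)

  Fits⇒Constrained : ∀ {D X T} → Fits (D , X) T → Constrained M r (D ∩ X) (D ∩ ∁ X) T
  Fits⇒Constrained {D} {X} {T} (indep , card , agree) = indep , card , sub , dis
    where
    sub : D ∩ X ⊆ T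
    sub {x} x∈ with x∈p∩q⁻ D X x∈
    ... | x∈D , x∈X = lookup⇒[]= x T (trans (sym (agree x x∈D)) ([]=⇒lookup x∈X))
    dis : Empty (T ∩ (D ∩ ∁ X))
    dis (x , x∈) with x∈p∩q⁻ T (D ∩ ∁ X) x∈
    ... | x∈T , x∈r with x∈p∩q⁻ D (∁ X) x∈r
    ...   | x∈D , x∈∁X =
      x∈∁p⇒x∉p x∈∁X (lookup⇒[]= x X (trans (agree x x∈D) ([]=⇒lookup x∈T)))

  Constrained⇒Fits : ∀ {D X T} → Constrained M r (D ∩ X) (D ∩ ∁ X) T → Fits (D , X) T
  Constrained⇒Fits {D} {X} {T} (indep , card , sub , dis) = indep , card , agree
    where
    agree : Agree D X T
    agree i i∈D with i ∈? X
    ... | yes i∈X = trans ([]=⇒lookup i∈X) (sym ([]=⇒lookup (sub (x∈p∩q⁺ (i∈D , i∈X)))))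
    ... | no  i∉X with i ∈? T
    ...   | yes i∈T = contradiction (i , x∈p∩q⁺ (i∈T , x∈p∩q⁺ (i∈D , x∉p⇒x∈∁p i∉X))) dis
    ...   | no  i∉T = trans (outside-lookup i∉X) (sym (outside-lookup i∉T))
      where
      outside-lookup : ∀ {A} → i ∉ A → lookup A i ≡ outside
      outside-lookup {A} i∉A with lookup A i in eq
      ... | true  = contradiction (lookup⇒[]= i A eq) i∉A
      ... | false = refl

  -- as: tasks whose solution is already output, bs: the others.
  unannounced : Subset n → (bs as : List (Task n)) → ℕ
  unannounced T bs as = sum (List.map (λ t → ⟦ fits? t T ⟧) bs) +
                        sum (List.map (λ t → ⟦ other? t T ⟧) as)

  -- The stacks after a task t whose solution has been output was processed.
  data Successor (t : Task n) (as bs : List (Task n)) :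
                 (as′ bs′ : List (Task n)) → Set where
    unique  : (∀ T → Fits t T → T ≡ proj₂ t) → Successor t as bs as bs
    divided : ∀ {Y} → Fits t Y → Y ≢ proj₂ t →
              let D = addFirstDiff true (proj₁ t) (proj₂ t) Y in
              Successor t as bs ((D , proj₂ t) ∷ as) ((D , Y) ∷ bs)

  announce-count : ∀ t T → Valid t → ⟦ fits? t T ⟧ ≡ ⟦ proj₂ t ≟ˢ T ⟧ + ⟦ other? t T ⟧
  announce-count t@(_ , X) T valid = ⟦⟧-partition (fits? t T) (X ≟ˢ T) (other? t T)
    split (λ { refl → valid }) proj₁ λ eq (_ , neq) → neq (sym eq)
    where
    split : Fits t T → (X ≡ T) ⊎ (Fits t T × T ≢ X)
    split fits with X ≟ˢ T
    ... | yes eq = inj₁ eq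
    ... | no neq = inj₂ (fits , λ eq → neq (sym eq))

  private
    third : ∀ {a b c : Bool} → a ≢ b → c ≢ a → c ≡ b
    third {false} {false} a≢b c≢a = contradiction refl a≢b
    third {true}  {true}  a≢b c≢a = contradiction refl a≢b
    third {false} {true}  {false} a≢b c≢a = contradiction refl c≢a
    third {false} {true}  {true}  a≢b c≢a = refl
    third {true}  {false} {false} a≢b c≢a = refl
    third {true}  {false} {true}  a≢b c≢a = contradiction refl c≢a

  module Division {D X Y : Subset n} (valid : Valid (D , X)) (fitsY : Fits (D , X) Y)
                  (Y≢X : Y ≢ X) where

    D′ : Subset n
    D′ = addFirstDiff true D X Y

    private
      diff = addFirstDiff-true D X Y (λ eq → Y≢X (sym eq))
      e = proj₁ diff
      X≢Y-at-e = proj₁ (proj₂ diff)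

    D′≡ : D′ ≡ D ∪ ⁅ e ⁆
    D′≡ = proj₂ (proj₂ diff)

    e∈D′ : e ∈ D′
    e∈D′ = subst (e ∈_) (sym D′≡) (q⊆p∪q D ⁅ e ⁆ (x∈⁅x⁆ e))

    D⊆D′ : D ⊆ D′
    D⊆D′ x∈ = subst (_ ∈_) (sym D′≡) (p⊆p∪q ⁅ e ⁆ x∈)

    extend : ∀ Z T → Agree D Z T → lookup Z e ≡ lookup T e → Agree D′ Z T
    extend Z T agree at-e i i∈ with x∈p∪q⁻ D ⁅ e ⁆ (subst (i ∈_) D′≡ i∈)
    ... | inj₁ i∈D = agree i i∈D
    ... | inj₂ i∈e rewrite x∈⁅y⁆⇒x≡y e i∈e = at-e

    validX : Valid (D′ , X)
    validX = proj₁ valid , proj₁ (proj₂ valid) , λ _ _ → refl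

    validY : Valid (D′ , Y)
    validY = proj₁ fitsY , proj₁ (proj₂ fitsY) , λ _ _ → refl

    -- `X` and `Y` agree on `D` but not at `e`, so `e` is new.
    ∣D′∣ : ∣ D′ ∣ ≡ suc ∣ D ∣
    ∣D′∣ = trans (cong ∣_∣ D′≡) (trans (∣p∪q∣≡∣p∣+∣q∣ D ⁅ e ⁆ e∉D)
      (trans (cong (∣ D ∣ +_) (∣⁅x⁆∣≡1 e)) (+-comm ∣ D ∣ 1)))
      where
      e∉D : Empty (D ∩ ⁅ e ⁆)
      e∉D (x , x∈) with x∈p∩q⁻ D ⁅ e ⁆ x∈
      ... | x∈D , x∈e rewrite x∈⁅y⁆⇒x≡y e x∈e = X≢Y-at-e (proj₂ (proj₂ fitsY) e x∈D)

    weight-D : weight (n ∸ ∣ D ∣) ≡ suc (weight (n ∸ ∣ D′ ∣) + weight (n ∸ ∣ D′ ∣))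
    weight-D = cong weight (trans
      -- The subtraction is not truncated: `suc ∣ D ∣` is the cardinality of `D′`, hence at most
      -- `n`.
      (+-∸-assoc 1 (subst (_≤ n) ∣D′∣ (∣p∣≤n D′)))
      (cong (λ k → suc (n ∸ k)) (sym ∣D′∣)))

    -- The bit at `e` decides to which half a solution belongs, because `X` and `Y` have opposite
    -- bits there. In the half of `Y` the condition `T ≢ X` is automatic.
    count : ∀ T → ⟦ other? (D , X) T ⟧ ≡ ⟦ fits? (D′ , Y) T ⟧ + ⟦ other? (D′ , X) T ⟧
    count T = ⟦⟧-partition (other? (D , X) T) (fits? (D′ , Y) T) (other? (D′ , X) T)
      split fromY fromX
      λ (_ , _ , Y~T) ((_ , _ , X~T) , _) →
        X≢Y-at-e (trans (X~T e e∈D′) (sym (Y~T e e∈D′)))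
      where
      split : Fits (D , X) T × T ≢ X → Fits (D′ , Y) T ⊎ (Fits (D′ , X) T × T ≢ X)
      split ((indep , card , X~T) , T≢X) with lookup X e Bool.≟ lookup T e
      ... | yes at-e = inj₂ ((indep , card , extend X T X~T at-e) , T≢X)
      ... | no  not-X = inj₁ (indep , card ,
        extend Y T (λ i i∈ → trans (sym (proj₂ (proj₂ fitsY) i i∈)) (X~T i i∈))
               (sym (third X≢Y-at-e λ eq → not-X (sym eq))))
      fromX : Fits (D′ , X) T × T ≢ X → Fits (D , X) T × T ≢ X
      fromX ((indep , card , X~T) , T≢X) = (indep , card , λ i i∈ → X~T i (D⊆D′ i∈)) , T≢X
      fromY : Fits (D′ , Y) T → Fits (D , X) T × T ≢ X
      fromY (indep , card , Y~T) =
        (indep , card , λ i i∈ → trans (proj₂ (proj₂ fitsY) i i∈) (Y~T i (D⊆D′ i∈))) ,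
        λ { refl → X≢Y-at-e (sym (Y~T e e∈D′)) }

  module _ {t : Task n} (valid : Valid t) {as bs as′ bs′ : List (Task n)} where

    successor-valid : Successor t as bs as′ bs′ →
                      All Valid as → All Valid bs → All Valid as′ × All Valid bs′
    successor-valid (unique _)         va vb = va , vb
    successor-valid (divided fits neq) va vb = validX ∷ va , validY ∷ vb
      where open Division valid fits neq

    -- The one element fixed in addition pays for the offset 1 on the old stack and for the `suc` in
    -- the hypothesis on the new one. A round with two splits raises either stack by one and fixes
    -- two elements, which the factor 2 in `Deep` records.
    successor-deep : Successor t as bs as′ bs′ →
                     2 * length as ≤ ∣ proj₁ t ∣ → 2 * length bs ≤ suc ∣ proj₁ t ∣ →
                     Deep 1 as → Deep 0 bs → Deep 1 as′ × Deep 0 bs′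
    successor-deep (unique _)         la lb da db = da , db
    successor-deep (divided fits neq) la lb da db =
      (subst (_ ≤_) (sym ∣D′∣) (s≤s la) , da) , (subst (_ ≤_) (sym ∣D′∣) lb , db)
      where open Division valid fits neq

    -- Used with `d` equal to 0 after a new task and to 1 after an old one, heights being taken with
    -- that task removed.
    successor-height : ∀ d → Successor t as bs as′ bs′ →
                       length bs ≡ d + length as → length bs′ ≡ d + length as′
    successor-height d (unique _)    eq = eq
    successor-height d (divided _ _) eq = trans (cong suc eq) (sym (+-suc d (length as)))

    -- A task that disappears had positive weight; a task that splits had weight `suc (w + w)` and
    -- leaves two of weight `w`.
    successor-measure : Successor t as bs as′ bs′ →
      measure bs′ + measure as′ < weight (n ∸ ∣ proj₁ t ∣) + (measure bs + measure as)
    successor-measure (unique _) = +-monoˡ-≤ _ (weight>0 (n ∸ ∣ proj₁ t ∣))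
    successor-measure (divided fits neq) = ≤-reflexive (trans
      (cong suc (interchange +-commutativeSemigroup w (measure bs) w (measure as)))
      (cong (_+ (measure bs + measure as)) (sym weight-D)))
      where
      open Division valid fits neq
      w = weight (n ∸ ∣ D′ ∣)

    -- What an already output task still owes is its other solutions, and a split hands exactly
    -- these on to the two halves.
    successor-count : Successor t as bs as′ bs′ → ∀ T →
      unannounced T bs′ as′ ≡ ⟦ other? t T ⟧ + unannounced T bs as
    successor-count (unique uniq) T =
      sym (cong (_+ unannounced T bs as) (⟦⟧-no (other? t T) λ (fits , neq) → neq (uniq T fits)))
    successor-count (divided {Y} fits neq) T = trans
      (interchange +-commutativeSemigroup ⟦ fits? (D′ , Y) T ⟧ _ ⟦ other? (D′ , proj₂ t) T ⟧ _)
      (cong (_+ unannounced T bs as) (sym (count T)))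
      where open Division valid fits neq

-- Traces

outputs-++ : (es fs : Trace n) → outputs (es ++ fs) ≡ outputs es ++ outputs fs
outputs-++ []                fs = refl
outputs-++ (output A   ∷ es) fs = cong (A ∷_) (outputs-++ es fs)
outputs-++ (query _ _  ∷ es) fs = outputs-++ es fs
outputs-++ (call _ _ _ ∷ es) fs = outputs-++ es fs

#calls-++ : (es fs : Trace n) → #calls (es ++ fs) ≡ #calls es + #calls fs
#calls-++ []                fs = refl
#calls-++ (output A   ∷ es) fs = #calls-++ es fs
#calls-++ (query _ _  ∷ es) fs = #calls-++ es fs
#calls-++ (call _ _ _ ∷ es) fs = cong suc (#calls-++ es fs)

#queries-++ : (es fs : Trace n) → #queries (es ++ fs) ≡ #queries es + #queries fs
#queries-++ []                fs = refl
#queries-++ (output A   ∷ es) fs = #queries-++ es fs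
#queries-++ (query _ _  ∷ es) fs = cong suc (#queries-++ es fs)
#queries-++ (call _ _ _ ∷ es) fs = #queries-++ es fs

segments-++ : (es fs : Trace n) → outputs es ≡ [] →
              segments (es ++ fs) ≡ (es ++ head (segments fs)) ∷ tail (segments fs)
segments-++ []                fs eq = refl
segments-++ (query i A  ∷ es) fs eq = cong (cut (query i A)) (segments-++ es fs eq)
segments-++ (call I E X ∷ es) fs eq = cong (cut (call I E X)) (segments-++ es fs eq)

module _ (M : TwoMatroids n) (r Q : ℕ) where

  record CallTrace (es : Trace n) : Set where
    field
      silent      : outputs es ≡ []
      one-call    : #calls es ≡ 1
      queries≤    : #queries es ≤ Q
      admissible  : All (AdmissibleEvent M r) es

  open CallTrace

  -- One constructor per kind of round; delay, number of calls and admissibility are all read off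
  -- this shape.
  data Paced : Trace n → Set where
    last : ∀ {X cs} → CallTrace cs → Paced (output X ∷ cs)
    more : ∀ {X cs ds es} → CallTrace cs → CallTrace ds → Paced es →
           Paced ((output X ∷ cs ++ ds) ++ es)

  callTrace : ∀ {In Ex X} → Empty (In ∩ Ex) → Constrained M r In Ex X → ∀ qs → length qs ≤ Q →
              CallTrace (call In Ex X ∷ List.map (liftQuery In Ex) qs)
  callTrace {In} {Ex} disj sol qs qs≤ = record
    { silent     = quiet qs
    ; one-call   = cong suc (no-calls qs)
    ; queries≤   = ≤-trans (≤-reflexive (count qs)) qs≤
    ; admissible = call disj sol ∷ all-queries qs
    }
    where
    quiet : ∀ qs → outputs (List.map (liftQuery In Ex) qs) ≡ []
    quiet []       = refl
    quiet (_ ∷ qs) = quiet qs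
    no-calls : ∀ qs → #calls (List.map (liftQuery In Ex) qs) ≡ 0
    no-calls []       = refl
    no-calls (_ ∷ qs) = no-calls qs
    count : ∀ qs → #queries (List.map (liftQuery In Ex) qs) ≡ length qs
    count []       = refl
    count (_ ∷ qs) = cong suc (count qs)
    all-queries : ∀ qs → All (AdmissibleEvent M r) (List.map (liftQuery In Ex) qs)
    all-queries []       = []
    all-queries (_ ∷ qs) = query ∷ all-queries qs

  module _ {cs ds : Trace n} (c : CallTrace cs) (d : CallTrace ds) where

    pair-silent : outputs (cs ++ ds) ≡ []
    pair-silent = trans (outputs-++ cs ds) (cong₂ _++_ (silent c) (silent d))

    pair-calls : #calls (cs ++ ds) ≡ 2
    pair-calls = trans (#calls-++ cs ds) (cong₂ _+_ (one-call c) (one-call d))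

    pair-queries : #queries (cs ++ ds) ≤ 2 * Q
    pair-queries = ≤-trans (≤-reflexive (#queries-++ cs ds))
      (+-mono-≤ (queries≤ c) (≤-trans (queries≤ d) (m≤m+n Q 0)))

    outputs-pair-++ : ∀ es → outputs ((cs ++ ds) ++ es) ≡ outputs es
    outputs-pair-++ es = trans (outputs-++ (cs ++ ds) es) (cong (_++ outputs es) pair-silent)

  paced-admissible : ∀ {es} → Paced es → All (AdmissibleEvent M r) es
  paced-admissible (last c)     = output ∷ admissible c
  paced-admissible (more c d p) =
    output ∷ ++⁺ (++⁺ (admissible c) (admissible d)) (paced-admissible p)

  -- The `suc` makes up for the second call missing in the last round and avoids subtraction in the
  -- induction.
  paced-calls : ∀ {es} → Paced es → suc (#calls es) ≡ 2 * length (outputs es)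
  paced-calls (last {cs = cs} c) rewrite silent c | one-call c = refl
  paced-calls (more {X} {cs} {ds} {es} c d p)
    rewrite outputs-pair-++ c d es | #calls-++ (cs ++ ds) es | pair-calls c d
          | *-suc 2 (length (outputs es)) =
    cong (λ k → suc (suc k)) (paced-calls p)

  Short : Trace n → Set
  Short seg = #calls seg ≤ 2 × #queries seg ≤ 2 * Q

  -- The empty head belongs to the induction: since the next round opens with its output, the calls
  -- of a round form a whole segment.
  paced-segments : ∀ {es} → Paced es → head (segments es) ≡ [] × All Short (tail (segments es))
  paced-segments (last {X} {cs} c) = refl ,
    subst (λ ss → All Short (List⁺.toList ss)) (sym eq)
      ((subst (_≤ 2) (sym (one-call c)) (s≤s z≤n) , ≤-trans (queries≤ c) (m≤m+n Q (Q + 0))) ∷ [])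
    where
    eq : segments cs ≡ cs ∷ []
    eq = trans (cong segments (sym (++-identityʳ cs)))
      (trans (segments-++ cs [] (silent c)) (cong (_∷ []) (++-identityʳ cs)))
  paced-segments (more {X} {cs} {ds} {es} c d p) with paced-segments p
  ... | head≡ , shorts = refl ,
    subst (λ ss → All Short (List⁺.toList ss)) (sym eq)
      ((≤-reflexive (pair-calls c d) , pair-queries c d) ∷ shorts)
    where
    eq : segments ((cs ++ ds) ++ es) ≡ (cs ++ ds) ∷ tail (segments es)
    eq = trans (segments-++ (cs ++ ds) es (pair-silent c d))
      (cong (_∷ tail (segments es)) (trans (cong ((cs ++ ds) ++_) head≡) (++-identityʳ (cs ++ ds))))

  paced-delay : ∀ {es} → Paced es → queryDelay es ≤ 2 * Q
  paced-delay {es} p with segments es | paced-segments p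
  ... | .[] ∷ segs | refl , shorts = go segs shorts
    where
    go : ∀ segs → All Short segs →
         List.foldr _⊔_ 0 (List.map #queries segs) ≤ 2 * Q
    go []         []                = z≤n
    go (_ ∷ segs) ((_ , q≤) ∷ rest) = ⊔-lub q≤ (go segs rest)

-- The summands come from loading the task, announcing its solution, the call, and the split.
opaque
  taskSpace : ℕ → ℕ → ℕ
  taskSpace n b = (1 + (n * 3 + 0)) + (0 + ((b + suc n) + (3 + (n * 6 + 0))))

roundSpace : ℕ → ℕ → ℕ
roundSpace n b = taskSpace n b + (1 + taskSpace n b)

-- Two stacks of height at most `suc n`; a task takes three bits per element and one end marker.
stackSpace : ℕ → ℕ
stackSpace n = 2 * (suc n * (n * 3 + 1))

-- The main loop: runs, invariants and termination

module Enumerate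
  (P : AnotherAlgorithm) (A : ℕ → ℕ → ℕ) (B : ℕ → ℕ) (solves : SolvesAnother P A B)
  {n : ℕ} (M : TwoMatroids n) (r b : ℕ) (max : ∀ T → CommonIndep M T → ∣ T ∣ ≤ r)
  (B≤ : ∀ m → m ≤ n → B m ≤ b) where

  open Tasks M r
  open Phases (EnumStep P (oracles M))
  open Registers {EnumOp 7}

  private
    Q = A n r
    c = taskSpace n b

  ask announce : Prog
  ask      = op (call 3F 4F 5F 0F)
  announce = op (output 5F)

  config : (as bs : List (Task n)) → Store 7
  config as bs = store [] (encodeStack as) (encodeStack bs) [] [] [] []

  loaded : Task n → (as bs : List (Task n)) → Store 7
  loaded (D , X) as bs =
    store [] (encodeStack as) (encodeStack bs) (toList (D ∩ X)) (toList (D ∩ ∁ X)) (toList X) []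

  length-encode : (T? : Maybe (Subset n)) → length (encode T?) ≤ suc n
  length-encode nothing  = s≤s z≤n
  length-encode (just T) = ≤-reflexive (cong suc (length-toList T))

  partition≡ : (D X : Subset n) → (D ∩ X) ∪ (D ∩ ∁ X) ≡ D
  partition≡ D X = trans (sym (∩-distribˡ-∪ D X (∁ X)))
    (trans (cong (D ∩_) (p∪∁p≡⊤ X)) (∩-identityʳ D))

  parts-disjoint : (D X : Subset n) → Empty ((D ∩ X) ∩ (D ∩ ∁ X))
  parts-disjoint D X (x , x∈) =
    let (l , r) = x∈p∩q⁻ (D ∩ X) (D ∩ ∁ X) x∈ in
    x∈∁p⇒x∉p (proj₂ (x∈p∩q⁻ D (∁ X) r)) (proj₂ (x∈p∩q⁻ D X l))

  announce′ : ∀ t as bs → Grows announce (loaded t as bs) (loaded t as bs) (output (proj₂ t) ∷ []) 0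
  announce′ t as bs = grows (op (output (proj₂ t) refl)) (⊔-lub ≤-refl (m≤m+n _ 0)) (m≤m+n _ 0)

  ask′ : ∀ t as bs → Valid t →
    ∃[ T? ] ∃[ cs ] IsOther M r (proj₁ t ∩ proj₂ t) (proj₁ t ∩ ∁ (proj₂ t)) (proj₂ t) T? ×
      CallTrace M r Q cs ×
      Grows ask (loaded t as bs) (loaded t as bs [ 0F ]≔ encode T?) cs (b + suc n)
  ask′ t@(D , X) as bs valid
    with ConstrainedSubproblem.another M r max (D ∩ X) (D ∩ ∁ X) X (parts-disjoint D X)
           (Fits⇒Constrained valid) solves
  ... | T? , qs , s , answers , other , qs≤ , s≤ =
    T′ , _ , other ,
    callTrace M r Q (parts-disjoint D X) (Fits⇒Constrained valid) qs qs≤ ,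
    grows (op (call (D ∩ X) (D ∩ ∁ X) X refl refl refl answers))
      -- The peak during the call includes `n` cells for a lifted query, and afterwards an answer of
      -- at most `suc n` bits remains; `b + suc n` covers both.
      (⊔-lub (+-monoʳ-≤ (size σ) (+-mono-≤ s≤b (n≤1+n n))) final)
      final
    where
    T′ = Maybe.map (lift (D ∩ X) (D ∩ ∁ X)) T?
    σ = loaded t as bs
    s≤b : s ≤ b
    s≤b = ≤-trans s≤ (B≤ _ (∣p∣≤n (free (D ∩ X) (D ∩ ∁ X))))
    final : size (σ [ 0F ]≔ encode T′) ≤ size σ + (b + suc n)
    final = ≤-trans (size-update-≤ σ 0F (encode T′))
      (+-monoʳ-≤ (size σ) (≤-trans (length-encode T′) (m≤n+m _ b)))

  conclude′ : ∀ t as bs → Valid t →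
    ∃[ as′ ] ∃[ bs′ ] ∃[ cs ] Successor t as bs as′ bs′ × CallTrace M r Q cs ×
      Grows (ask ⨾ case 0F skip discard split) (loaded t as bs) (config as′ bs′) cs
            ((b + suc n) + (3 + (n * 6 + 0)))
  conclude′ t@(D , X) as bs valid with ask′ t as bs valid
  ... | nothing , cs , none , trace , R =
    as , bs , cs , unique (λ T fits → none T (Fits⇒Constrained fits)) , trace ,
    subst (λ es → Grows _ _ _ es _) (++-identityʳ cs)
      -- Discarding needs no space; its bound is raised to that of the other branch.
      (R ⨾′ weaken z≤n (false′ refl discard′))
  ... | just Y , cs , (sol , Y≢X) , trace , R =
    _ , _ , cs , divided (Constrained⇒Fits sol) Y≢X , trace ,
    subst (λ es → Grows _ _ _ es _) (++-identityʳ cs)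
      (R ⨾′ true′ refl
        -- `split` sees `D` only as the union of In and Ex, which `partition≡` identifies with `D`.
        (subst (λ D″ → Grows split (loaded t as bs [ 0F ]≔ toList Y)
                         (store [] (stash (addFirstDiff true D″ X Y) X _)
                                   (stash (addFirstDiff true D″ X Y) Y _) [] [] [] []) [] _)
               (partition≡ D X)
               (split′ (D ∩ X) (D ∩ ∁ X) X Y)))

  opaque
    unfolding processTask taskSpace

    processNew : ∀ t as bs → Valid t →
      ∃[ as′ ] ∃[ bs′ ] ∃[ cs ] Successor t as bs as′ bs′ × CallTrace M r Q cs ×
        Grows (processTask 2F announce ask) (config as (t ∷ bs)) (config as′ bs′)
              (output (proj₂ t) ∷ cs) c
    processNew t@(D , X) as bs valid with conclude′ t as bs valid
    ... | as′ , bs′ , cs , next , trace , R =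
      as′ , bs′ , cs , next , trace , load′ true D X ⨾′ announce′ t as bs ⨾′ R

    processOld : ∀ t as bs → Valid t →
      ∃[ as′ ] ∃[ bs′ ] ∃[ cs ] Successor t as bs as′ bs′ × CallTrace M r Q cs ×
        Grows (processTask 1F skip ask) (config (t ∷ as) bs) (config as′ bs′) cs c
    processOld t@(D , X) as bs valid with conclude′ t as bs valid
    ... | as′ , bs′ , cs , next , trace , R =
      as′ , bs′ , cs , next , trace , load′ false D X ⨾′ skip′ ⨾′ R

  record Invariant (as bs : List (Task n)) : Set where
    constructor invariant
    field
      valid : All Valid as × All Valid bs
      deep  : Deep 1 as × Deep 0 bs

  open Invariant

  length-encodeStack : (ts : List (Task n)) → length (encodeStack ts) ≡ length ts * (n * 3 + 1)
  length-encodeStack []             = refl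
  length-encodeStack ((D , X) ∷ ts) = trans (length-stash D X _)
    (trans (cong (λ k → n * 3 + suc k) (length-encodeStack ts))
           (sym (+-assoc (n * 3) 1 (length ts * (n * 3 + 1)))))

  encodeStack≤ : ∀ d (ts : List (Task n)) → Deep d ts →
                 length (encodeStack ts) ≤ suc n * (n * 3 + 1)
  encodeStack≤ d ts deep = ≤-trans (≤-reflexive (length-encodeStack ts))
    (*-monoˡ-≤ (n * 3 + 1) (Deep⇒height≤ d ts deep))

  config≤ : ∀ {as bs} → Invariant as bs → size (config as bs) ≤ stackSpace n
  config≤ inv =
    +-mono-≤ (encodeStack≤ 1 _ (proj₁ (deep inv)))
             (+-monoˡ-≤ 0 (encodeStack≤ 0 _ (proj₂ (deep inv))))

  body : Prog
  body = processTask 2F announce ask ⨾ when 1F (processTask 1F skip ask)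

  LoopRun : (as bs : List (Task n)) → Trace n → Set
  LoopRun as bs es =
    ∃[ s ] Run (EnumStep P (oracles M)) (while 2F body) (config as bs) (config [] []) es s ×
           s ≤ stackSpace n + roundSpace n b

  record Loop (as bs : List (Task n)) : Set where
    constructor loop
    field
      {trace} : Trace n
      run     : LoopRun as bs trace
      paced   : Paced M r Q trace
      count   : ∀ T → multiplicity T (outputs trace) ≡ unannounced T bs as

  stop : LoopRun [] [] []
  stop = _ , while-done refl , z≤n

  -- Growth adds up under composition and would accumulate over all rounds. Every round starts from
  -- a configuration within `stackSpace`, so here relative bounds give way to an absolute one and
  -- the rounds are combined by a maximum.
  enter : ∀ t as′ bs′ {as bs es fs g} → Invariant as (t ∷ bs) →
    Grows body (config as (t ∷ bs)) (config as′ bs′) es g → g ≤ roundSpace n b →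
    LoopRun as′ bs′ fs → LoopRun as (t ∷ bs) (es ++ fs)
  enter (D , X) _ _ {bs = bs} inv (grows R s≤ _) g≤ (_ , R′ , s′≤) =
    _ , while-loop (proj₂ (proj₂ (stash-nonempty D X false (encodeStack bs)))) R R′ ,
    ⊔-lub (≤-trans s≤ (+-mono-≤ (config≤ inv) g≤)) s′≤

  advance : ∀ {t as bs as′ bs′} → Valid t → Successor t as bs as′ bs′ →
            Invariant as bs → 2 * length as ≤ ∣ proj₁ t ∣ → 2 * length bs ≤ suc ∣ proj₁ t ∣ →
            Invariant as′ bs′
  advance v next (invariant (va , vb) (da , db)) la lb =
    invariant (successor-valid v next va vb) (successor-deep v next la lb da db)

  private
    height-new : ∀ {d} (as bs : List (Task n)) → length bs ≡ length as → 2 * length bs ≤ d →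
                 2 * length as ≤ d
    height-new as bs eq = subst (λ k → 2 * k ≤ _) eq

    height-old : ∀ {d} (as bs : List (Task n)) → length bs ≡ suc (length as) →
                 suc (2 * length as) ≤ d → 2 * length bs ≤ suc d
    height-old {d} as bs eq le =
      subst (_≤ suc d) (sym (trans (cong (2 *_) eq) (*-suc 2 (length as)))) (s≤s le)

  -- Afterwards the new stack is still higher than the old one by one, so there is a next task `w`
  -- and the main loop continues.
  oldRound : ∀ u as bs → length bs ≡ suc (length as) → Invariant (u ∷ as) bs →
    ∃[ w ] ∃[ as′ ] ∃[ bs′ ] ∃[ ds ]
      length bs′ ≡ length as′ × Invariant as′ (w ∷ bs′) × CallTrace M r Q ds ×
      Grows (when 1F (processTask 1F skip ask)) (config (u ∷ as) bs) (config as′ (w ∷ bs′))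
            ds (1 + c) ×
      measure (w ∷ bs′) + measure as′ < measure bs + measure (u ∷ as) ×
      (∀ T → unannounced T (w ∷ bs′) as′ ≡ unannounced T bs (u ∷ as))
  oldRound u@(D , X) as bs eq (invariant (vu ∷ va , vb) ((le , da) , db))
    with processOld u as bs vu
  ... | as′ , [] , ds , next , trace , R with () ← successor-height vu 1 next eq
  ... | as′ , w ∷ bs″ , ds , next , trace , R =
    w , as′ , bs″ , ds , suc-injective (successor-height vu 1 next eq) ,
    advance vu next (invariant (va , vb) (da , db))
            (≤-trans (n≤1+n _) le) (height-old as bs eq le) ,
    trace , when′ (proj₂ (proj₂ (stash-nonempty D X false (encodeStack as)))) R ,
    subst (measure (w ∷ bs″) + measure as′ <_)
          (x∙yz≈y∙xz +-commutativeSemigroup (weight (n ∸ ∣ D ∣)) (measure bs) (measure as))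
          (successor-measure vu next) ,
    λ T → trans (successor-count vu next T)
      (x∙yz≈y∙xz +-commutativeSemigroup ⟦ other? u T ⟧ (sum (List.map (λ t → ⟦ fits? t T ⟧) bs)) _)

  -- Each recursive step is a full round, and either of its two tasks lowers the measure.
  runLoop : ∀ t as bs → length bs ≡ length as → Invariant as (t ∷ bs) →
            Acc _<_ (measure (t ∷ bs) + measure as) → Loop as (t ∷ bs)
  runLoop t@(D , X) as bs eq inv@(invariant (va , vt ∷ vb) (da , (le , db))) (acc rs)
    with processNew t as bs vt
  ... | as₁ , bs₁ , cs , next , trace₁ , R₁
    with advance vt next (invariant (va , vb) (da , db)) (height-new as bs eq le)
                 (≤-trans le (n≤1+n _))
       | successor-height vt 0 next eq
       | subst (measure bs₁ + measure as₁ <_)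
               (sym (+-assoc (weight (n ∸ ∣ D ∣)) (measure bs) (measure as)))
               (successor-measure vt next)
       | newCount
    where
    newCount : ∀ T → ⟦ X ≟ˢ T ⟧ + unannounced T bs₁ as₁ ≡ unannounced T (t ∷ bs) as
    newCount T = trans (cong (⟦ X ≟ˢ T ⟧ +_) (successor-count vt next T))
      (trans (sym (+-assoc ⟦ X ≟ˢ T ⟧ ⟦ other? t T ⟧ _))
      (trans (cong (_+ unannounced T bs as) (sym (announce-count t T vt)))
             (sym (+-assoc ⟦ fits? t T ⟧ _ _))))
  -- The heights are equal by `eq₁`: if no old task is left, there is no new one either, and the
  -- loop ends after a single call.
  runLoop t as bs eq inv (acc rs)
      | [] , [] , cs , next , trace₁ , R₁ | inv₁ | eq₁ | less₁ | count₁ =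
    loop
      (subst (LoopRun as (t ∷ bs))
        (trans (++-identityʳ (output (proj₂ t) ∷ cs ++ []))
               (cong (output (proj₂ t) ∷_) (++-identityʳ cs)))
        (enter t [] [] inv (R₁ ⨾′ whenEmpty′) (+-monoʳ-≤ c z≤n) stop))
      (last trace₁)
      λ T → trans
        (cong (λ Ts → ⟦ proj₂ t ≟ˢ T ⟧ + multiplicity T Ts) (CallTrace.silent trace₁))
        (count₁ T)
  runLoop t as bs eq inv (acc rs)
      | u ∷ as₁ , bs₁ , cs , next , trace₁ , R₁ | inv₁ | eq₁ | less₁ | count₁
    with oldRound u as₁ bs₁ eq₁ inv₁
  ... | w , as₂ , bs₂ , ds , eq₂ , inv₂ , trace₂ , R₂ , less₂ , count₂
    with runLoop w as₂ bs₂ eq₂ inv₂ (rs (<-trans less₂ less₁))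
  ... | loop {es} R paced count =
    loop (enter t as₂ (w ∷ bs₂) inv (R₁ ⨾′ R₂) ≤-refl R) (more trace₁ trace₂ paced)
      λ T → trans
        (cong (λ Ts → ⟦ proj₂ t ≟ˢ T ⟧ + multiplicity T Ts)
              (outputs-pair-++ M r Q trace₁ trace₂ es))
        (trans (cong (⟦ proj₂ t ≟ˢ T ⟧ +_) (trans (count T) (count₂ T))) (count₁ T))

-- Number of solutions, total space and conclusion

HasSize⇒length : ∀ {n L} {p : Subset n → Set} {Ts : List (Subset n)} → Unique Ts →
                 (∀ T → T ∈ˡ Ts ⇔ p T) → p HasSize L → length Ts ≡ L
HasSize⇒length {Ts = Ts} uniq iff (Us , uniq′ , iff′ , refl) =
  -- Lists without repetition that have the same members are permutations of each other.
  ↭-length (∼bag⇒↭ (unique∧set⇒bag uniq uniq′ (λ {T} →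
    mk⇔ (λ T∈ → Equivalence.from (iff′ T) (Equivalence.to (iff T) T∈))
        (λ T∈ → Equivalence.from (iff T) (Equivalence.to (iff′ T) T∈)))))

totalSpace : ℕ → ℕ → ℕ
totalSpace n b = (n + (1 + n * 3)) + (stackSpace n + roundSpace n b)

opaque
  unfolding taskSpace

  -- The total is `6n² + 32n + 14 + 2b`; the summand added on the left completes its part in `n` to
  -- `18(n+1)²`.
  totalSpace-quadratic : ∀ n b → totalSpace n b + (12 * (n * n) + 4 * n + 4) ≡
                                 18 * (suc n * (suc n * 1)) + 2 * b
  totalSpace-quadratic = solve 2 (λ n b →
    let task = (con 1 :+ (n :* con 3 :+ con 0)) :+
               (con 0 :+ ((b :+ (con 1 :+ n)) :+ (con 3 :+ (n :* con 6 :+ con 0)))) in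
    (n :+ (con 1 :+ n :* con 3)) :+
      (con 2 :* ((con 1 :+ n) :* (n :* con 3 :+ con 1)) :+ (task :+ (con 1 :+ task))) :+
      (con 12 :* (n :* n) :+ con 4 :* n :+ con 4) :=
    con 18 :* ((con 1 :+ n) :* ((con 1 :+ n) :* con 1)) :+ con 2 :* b) refl
    where open +-*-Solver

totalSpace-polynomial : ∀ c d n →
  totalSpace n (c * suc n ^ d) ≤ (18 + 2 * c) * suc n ^ (2 + d)
totalSpace-polynomial c d n = begin
  totalSpace n b                                       ≤⟨ m≤m+n (totalSpace n b) _ ⟩
  totalSpace n b + (12 * (n * n) + 4 * n + 4)          ≡⟨ totalSpace-quadratic n b ⟩
  18 * suc n ^ 2 + 2 * b                               ≡⟨ cong (18 * suc n ^ 2 +_) (*-assoc 2 c _) ⟨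
  18 * suc n ^ 2 + 2 * c * suc n ^ d                   ≤⟨ +-mono-≤
    (*-monoʳ-≤ 18 (^-monoʳ-≤ (suc n) (m≤m+n 2 d)))
    (*-monoʳ-≤ (2 * c) (^-monoʳ-≤ (suc n) (m≤n+m d 2))) ⟩
  18 * suc n ^ (2 + d) + 2 * c * suc n ^ (2 + d)       ≡⟨ *-distribʳ-+ (suc n ^ (2 + d)) 18 (2 * c) ⟨
  (18 + 2 * c) * suc n ^ (2 + d)                       ∎
  where
  open ≤-Reasoning
  b = c * suc n ^ d

theorem6p1 : (P : AnotherAlgorithm) (A : ℕ → ℕ → ℕ) (B : ℕ → ℕ) →
    SolvesAnother P A B → PolynomiallyBounded B →
    ∃[ E ] ∃[ B′ ] ∃[ c ] PolynomiallyBounded B′ ×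
    (∀ {n} (M : TwoMatroids n) (S : Subset n) → MaxCommonIndep M S →
    ∃[ es ] ∃[ s ]
    Terminates E P (oracles M) S es s ×
    EnumeratesExactly (MaxCommonIndep M) es ×
    s ≤ B′ n ×
    queryDelay es ≤ c * A n ∣ S ∣ ×
    All (AdmissibleEvent M ∣ S ∣) es ×
    All (λ seg → #calls seg ≤ 2) (tail (segments es)) ×
    (∀ L → MaxCommonIndep M HasSize L → #calls es ≡ 2 * L ∸ 1))
theorem6p1 P A B solves (c , d , B≤) =
  -- The delay constant 2 is the number of calls per segment: the program makes no queries outside
  -- its calls.
  enumeration , (λ n → totalSpace n (c * suc n ^ d)) , 2 ,
  (18 + 2 * c , 2 + d , totalSpace-polynomial c d) ,
  enumerates
  where
  enumerates : ∀ {n} (M : TwoMatroids n) (S : Subset n) → MaxCommonIndep M S →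
    ∃[ es ] ∃[ s ]
    Terminates enumeration P (oracles M) S es s ×
    EnumeratesExactly (MaxCommonIndep M) es ×
    s ≤ totalSpace n (c * suc n ^ d) ×
    queryDelay es ≤ 2 * A n ∣ S ∣ ×
    All (AdmissibleEvent M ∣ S ∣) es ×
    All (λ seg → #calls seg ≤ 2) (tail (segments es)) ×
    (∀ L → MaxCommonIndep M HasSize L → #calls es ≡ 2 * L ∸ 1)
  enumerates {n} M S (S-common , S-max) = es , _ ,
    (config [] [] , (run (start′ S) ⨾ proj₁ (proj₂ loop-run))) ,
    (unique-outputs , outputs⇔) ,
    ⊔-lub (≤-trans (≤-trans (space≤ (start′ S)) (+-monoˡ-≤ _ (≤-reflexive initial-size)))
                   (m≤m+n (n + (1 + n * 3)) _))
          (≤-trans (proj₂ (proj₂ loop-run)) (m≤n+m _ (n + (1 + n * 3)))) ,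
    paced-delay M r Q paced , paced-admissible M r Q paced ,
    All.map proj₁ (proj₂ (paced-segments M r Q paced)) ,
    λ L size → trans (cong pred (paced-calls M r Q paced))
      (cong (λ k → 2 * k ∸ 1) (HasSize⇒length unique-outputs outputs⇔ size))
    where
    r = ∣ S ∣
    Q = A n r
    root : Task n
    -- With no element fixed, this task stands for all maximum common independent sets.
    root = ⊥ , S
    open Tasks M r
    open Phases (EnumStep P (oracles M))
    open Enumerate P A B solves M r (c * suc n ^ d) S-max
      -- Calls run on minors of various sizes `m`; the polynomial bound is monotone, so its value at
      -- `n` serves for all of them.
      (λ m m≤n → ≤-trans (B≤ m) (*-monoʳ-≤ c (^-monoˡ-≤ d (s≤s m≤n))))
    root-valid : Valid root
    root-valid = S-common , refl , λ _ _ → refl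
    open Loop (runLoop root [] [] refl
      (invariant ([] , root-valid ∷ []) (tt , (z≤n , tt))) (<-wellFounded _))
      renaming (trace to es; run to loop-run)
    initial-size : size (initial {6} (toList S)) ≡ n
    initial-size = trans (+-identityʳ _) (length-toList S)
    Fits⇒Max : ∀ {T} → Fits root T → MaxCommonIndep M T
    Fits⇒Max (common , card , _) =
      common , λ U U-common → subst (∣ U ∣ ≤_) (sym card) (S-max U U-common)
    Max⇒Fits : ∀ {T} → MaxCommonIndep M T → Fits root T
    Max⇒Fits {T} (common , max) =
      common , ≤-antisym (S-max T common) (max S S-common) , λ i i∈ → contradiction i∈ ∉⊥
    count-root : ∀ T → multiplicity T (outputs es) ≡ ⟦ fits? root T ⟧
    count-root T = trans (count T) (trans (+-identityʳ _) (+-identityʳ _))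
    ⟦⟧≤1 : ∀ {p : Set} (p? : Dec p) → ⟦ p? ⟧ ≤ 1
    ⟦⟧≤1 (yes _) = ≤-refl
    ⟦⟧≤1 (no _)  = z≤n
    unique-outputs : Unique (outputs es)
    unique-outputs = multiplicity≤1⇒Unique (outputs es)
      λ T → subst (_≤ 1) (sym (count-root T)) (⟦⟧≤1 (fits? root T))
    outputs⇔ : ∀ T → T ∈ˡ outputs es ⇔ MaxCommonIndep M T
    outputs⇔ T = mk⇔
      (λ T∈ → to (subst (1 ≤_) (count-root T) (∈⇒multiplicity>0 T∈)))
      (λ T-max → multiplicity>0⇒∈ (outputs es) (subst (1 ≤_) (sym (count-root T)) (from T-max)))
      where
      to : 1 ≤ ⟦ fits? root T ⟧ → MaxCommonIndep M T
      to pos with fits? root T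
      ... | yes fits = Fits⇒Max fits
      from : MaxCommonIndep M T → 1 ≤ ⟦ fits? root T ⟧
      from T-max with fits? root T
      ... | yes _   = ≤-refl
      ... | no ¬fits = contradiction (Max⇒Fits T-max) ¬fits
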